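{- Let $N=\{1,\dots,n\}$, suppose $\mathcal{I}\subseteq 2^N$ is the family of independent sets of a matroid on $N$, and let $s=\max\{|X|: X\in\mathcal{I}\}$. Assume the objective function $f\colon2^N\to\mathbb{R}_{\ge0}$ is non-negative, monotone, and $(\alpha,\beta_1,\beta_2)$-localizable with size $s$ and exchange size $2$. Let $X^*$ be an optimal solution of maximizing $f(X)$ subject to $X\in\mathcal{I}$. If $X$ is the solution obtained by executing $T$ iterations of the matroid local search algorithm (described in the context), then $$f(X)\ge\frac{\alpha}{\beta_1+\beta_2}\left(1-\exp\left(-\frac{(\beta_1+\beta_2)T}{s}\right)\right)f(X^*).$$ If $X$ is the output returned by the algorithm when it stops by finding no pair to improve the solution, then $$f(X)\ge\frac{\alpha}{\beta_1+\beta_2}f(X^*).$$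
   Context: Notation: $X+a=X\cup\{a\}$, $X-a=X\setminus\{a\}$, $X\triangle Y=(X\setminus Y)\cup(Y\setminus X)$. Monotone means $f(X)\le f(Y)$ whenever $X\subseteq Y\subseteq N$. Matroid local search algorithm: start with $X=\emptyset$ and add arbitrary elements until $X$ is maximal in $\mathcal{I}$. Then, for $i=1,\dots,T$: find a pair $x\in X$, $x'\in N\setminus X$ maximizing $f(X-x+x')$ among all pairs with $X-x+x'\in\mathcal{I}$. If $f(X-x+x')-f(X)>0$, replace $X$ by $X-x+x'$; otherwise stop and return $X$. After $T$ iterations return $X$. Localizability: for $\alpha,\beta_1,\beta_2\ge 0$, a non-negative monotone set function $f\colon 2^N\to\mathbb{R}_{\ge0}$ is $(\alpha,\beta_1,\beta_2)$-localizable with size $s$ and exchange size $t$ if for arbitrary subsets $X,X^*\subseteq N$ of size at most $s$ and any collection (multiset) $\mathcal{P}$ of subsets of $X\triangle X^*$ such that $|P|\le t$ for each $P\in\mathcal{P}$, we have $$\sum_{P\in\mathcal{P}}\{f(X\triangle P)-f(X)\}\ge\alpha k f(X^*)-(\beta_1\ell+\beta_2k)f(X),$$ where $k$ and $\ell$ are positive integers such that each element of $X^*\setminus X$ appears at least $k$ times in $\mathcal{P}$ and each element of $X\setminus X^*$ appears at most $\ell$ times in $\mathcal{P}$. -}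

module Defs where

open import Data.Fin.Base using (Fin)
open import Data.Fin.Subset as Subset
  using (Subset; _∈_; _∉_; _⊆_; _∪_; _─_; ⁅_⁆)
open import Data.Fin.Subset.Properties using (_∈?_)
open import Data.Integer.Base using (+_)
import Data.Integer.Base as ℤ
import Data.Integer.Properties as ℤₚ
open import Data.List.Base using (List; length; filter; foldr; map)
open import Data.List.Relation.Unary.All using (All)
open import Data.Nat.Base as ℕ using (ℕ; zero; suc; z≤n; s≤s)
import Data.Nat.Properties as ℕₚ
open import Data.Product.Base using (∃₂; ∃-syntax; _×_; _,_; proj₁; proj₂)
open import Data.Rational.Base as ℚ using (ℚ; 0ℚ; 1ℚ; ½)
import Data.Rational.Properties as ℚₚ
open import Data.Rational.Solver using (module +-*-Solver)
import Data.Rational.Unnormalised.Base as ℚᵘ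
import Data.Rational.Unnormalised.Properties as ℚᵘₚ
open import Data.Sum.Base using (_⊎_; [_,_]′)
open import Relation.Binary.PropositionalEquality
open import Relation.Nullary.Negation using (¬_)

module RationalLemmas where

  open +-*-Solver using (solve; _:+_; _:*_; :-_; _:-_; _:=_; con)
  open ℚₚ.≤-Reasoning

  ι : ℕ → ℚ
  ι n = + n ℚ./ 1

  inv : ℕ → ℚ
  inv k = + 1 ℚ./ suc k

  private
    /≃ : ∀ i d .{{_ : ℕ.NonZero d}} → ℚ.toℚᵘ (i ℚ./ d) ℚᵘ.≃ (i ℚᵘ./ d)
    /≃ i (suc d) = ℚₚ.toℚᵘ-fromℚᵘ (ℚᵘ.mkℚᵘ i d)

  ι-mono : ∀ {m n} → m ℕ.≤ n → ι m ℚ.≤ ι n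
  ι-mono {m} {n} m≤n = ℚₚ.toℚᵘ-cancel-≤
    (ℚᵘₚ.≤-respˡ-≃ (ℚᵘₚ.≃-sym (/≃ (+ m) 1))
    (ℚᵘₚ.≤-respʳ-≃ (ℚᵘₚ.≃-sym (/≃ (+ n) 1))
      (ℚᵘ.*≤* (ℤₚ.*-monoʳ-≤-nonNeg (+ 1) (ℤ.+≤+ m≤n)))))

  0≤ι : ∀ n → 0ℚ ℚ.≤ ι n
  0≤ι n = ι-mono {0} {n} z≤n

  ι-suc : ∀ n → ι (suc n) ≡ 1ℚ ℚ.+ ι n
  ι-suc n = ℚₚ.toℚᵘ-injective
    (ℚᵘₚ.≃-trans (/≃ (+ suc n) 1)
    (ℚᵘₚ.≃-sym (ℚᵘₚ.≃-trans (ℚₚ.toℚᵘ-homo-+ 1ℚ (ι n))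
    (ℚᵘₚ.≃-trans (ℚᵘₚ.+-congʳ (ℚ.toℚᵘ 1ℚ) (/≃ (+ n) 1))
      (ℚᵘ.*≡* (cong (λ z → (+ 1 ℤ.+ z) ℤ.* + 1) (ℤₚ.*-identityʳ (+ n))))))))

  ι*inv : ∀ k → ι (suc k) ℚ.* inv k ≡ 1ℚ
  ι*inv k = ℚₚ.toℚᵘ-injective
    (ℚᵘₚ.≃-trans (ℚₚ.toℚᵘ-homo-* (ι (suc k)) (inv k))
    (ℚᵘₚ.≃-trans (ℚᵘₚ.*-cong (/≃ (+ suc k) 1) (/≃ (+ 1) (suc k)))
      (ℚᵘₚ.*-inverseʳ (ℚᵘ.mkℚᵘ (+ suc k) 0))))

  0<inv : ∀ k → 0ℚ ℚ.< inv k
  0<inv k = ℚₚ.positive⁻¹ (inv k) {{ℚₚ.normalize-pos 1 (suc k)}}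

  bound : ℚ → ℕ
  bound p = ℤ.∣ ℚ.numerator p ∣

  ≤bound : ∀ p → p ℚ.≤ ι (bound p)
  ≤bound p@(ℚ.mkℚ i d _) = ℚₚ.toℚᵘ-cancel-≤
    (ℚᵘₚ.≤-respʳ-≃ (ℚᵘₚ.≃-sym (/≃ (+ bound p) 1))
      (ℚᵘ.*≤* (lemma i d)))
    where
    lemma : ∀ i d → i ℤ.* + 1 ℤ.≤ + ℤ.∣ i ∣ ℤ.* + suc d
    lemma i d = ℤₚ.≤-trans
      (ℤₚ.≤-reflexive (ℤₚ.*-identityʳ i))
      (ℤₚ.≤-trans (i≤∣i∣ i)
      (ℤₚ.≤-trans (ℤ.+≤+ (ℕₚ.m≤m*n ℤ.∣ i ∣ (suc d)))
        (ℤₚ.≤-reflexive (ℤₚ.pos-* ℤ.∣ i ∣ (suc d)))))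
      where
      i≤∣i∣ : ∀ i → i ℤ.≤ + ℤ.∣ i ∣
      i≤∣i∣ (+ n) = ℤₚ.≤-refl
      i≤∣i∣ (ℤ.-[1+ n ]) = ℤ.-≤+

  *-monoˡ : ∀ {r p q} → 0ℚ ℚ.≤ r → p ℚ.≤ q → r ℚ.* p ℚ.≤ r ℚ.* q
  *-monoˡ {r} 0≤r p≤q = ℚₚ.*-monoˡ-≤-nonNeg r {{ℚ.nonNegative 0≤r}} p≤q

  *-monoʳ : ∀ {r p q} → 0ℚ ℚ.≤ r → p ℚ.≤ q → p ℚ.* r ℚ.≤ q ℚ.* r
  *-monoʳ {r} 0≤r p≤q = ℚₚ.*-monoʳ-≤-nonNeg r {{ℚ.nonNegative 0≤r}} p≤q

  *-mono : ∀ {p q r s} → 0ℚ ℚ.≤ r → 0ℚ ℚ.≤ q → p ℚ.≤ q → r ℚ.≤ s →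
           p ℚ.* r ℚ.≤ q ℚ.* s
  *-mono 0≤r 0≤q p≤q r≤s = ℚₚ.≤-trans (*-monoʳ 0≤r p≤q) (*-monoˡ 0≤q r≤s)

  0≤* : ∀ {p q} → 0ℚ ℚ.≤ p → 0ℚ ℚ.≤ q → 0ℚ ℚ.≤ p ℚ.* q
  0≤* {p} {q} 0≤p 0≤q = subst (ℚ._≤ p ℚ.* q) (ℚₚ.*-zeroʳ p) (*-monoˡ 0≤p 0≤q)

  0<* : ∀ {p q} → 0ℚ ℚ.< p → 0ℚ ℚ.< q → 0ℚ ℚ.< p ℚ.* q
  0<* {p} {q} 0<p 0<q = subst (ℚ._< p ℚ.* q) (ℚₚ.*-zeroʳ p)
    (ℚₚ.*-monoʳ-<-pos p {{ℚ.positive 0<p}} 0<q)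

  0<1/ : ∀ {p} (0<p : 0ℚ ℚ.< p) → 0ℚ ℚ.< (ℚ.1/ p) {{ℚ.>-nonZero 0<p}}
  0<1/ {p} 0<p = ℚₚ.positive⁻¹ _ {{ℚₚ.1/pos⇒pos p {{ℚ.positive 0<p}}}}

  ≤+ : ∀ {p q} → 0ℚ ℚ.≤ q → p ℚ.≤ p ℚ.+ q
  ≤+ {p} {q} 0≤q = subst (ℚ._≤ p ℚ.+ q) (ℚₚ.+-identityʳ p) (ℚₚ.+-monoʳ-≤ p 0≤q)

  ∣-∣-swap : ∀ p q → ℚ.∣ p ℚ.- q ∣ ≡ ℚ.∣ q ℚ.- p ∣
  ∣-∣-swap p q = trans (sym (ℚₚ.∣-p∣≡∣p∣ (p ℚ.- q)))
    (cong ℚ.∣_∣ (solve 2 (λ p q → :- (p :- q) := q :- p) refl p q))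

  ∣-∣-triangle : ∀ p q r → ℚ.∣ p ℚ.- r ∣ ℚ.≤ ℚ.∣ p ℚ.- q ∣ ℚ.+ ℚ.∣ q ℚ.- r ∣
  ∣-∣-triangle p q r = begin
    ℚ.∣ p ℚ.- r ∣
      ≡⟨ cong ℚ.∣_∣ (solve 3 (λ p q r → p :- r := (p :- q) :+ (q :- r)) refl p q r) ⟩
    ℚ.∣ (p ℚ.- q) ℚ.+ (q ℚ.- r) ∣
      ≤⟨ ℚₚ.∣p+q∣≤∣p∣+∣q∣ (p ℚ.- q) (q ℚ.- r) ⟩
    ℚ.∣ p ℚ.- q ∣ ℚ.+ ℚ.∣ q ℚ.- r ∣ ∎

  ∣*-*∣≤ : ∀ a b c d → ℚ.∣ a ℚ.* b ℚ.- c ℚ.* d ∣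
         ℚ.≤ ℚ.∣ a ∣ ℚ.* ℚ.∣ b ℚ.- d ∣ ℚ.+ ℚ.∣ a ℚ.- c ∣ ℚ.* ℚ.∣ d ∣
  ∣*-*∣≤ a b c d = begin
    ℚ.∣ a ℚ.* b ℚ.- c ℚ.* d ∣
      ≤⟨ ∣-∣-triangle (a ℚ.* b) (a ℚ.* d) (c ℚ.* d) ⟩
    ℚ.∣ a ℚ.* b ℚ.- a ℚ.* d ∣ ℚ.+ ℚ.∣ a ℚ.* d ℚ.- c ℚ.* d ∣
      ≡⟨ cong₂ (λ u v → ℚ.∣ u ∣ ℚ.+ ℚ.∣ v ∣)
           (solve 3 (λ a b d → a :* b :- a :* d := a :* (b :- d)) refl a b d)
           (solve 3 (λ a c d → a :* d :- c :* d := (a :- c) :* d) refl a c d) ⟩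
    ℚ.∣ a ℚ.* (b ℚ.- d) ∣ ℚ.+ ℚ.∣ (a ℚ.- c) ℚ.* d ∣
      ≡⟨ cong₂ ℚ._+_ (ℚₚ.∣p*q∣≡∣p∣*∣q∣ a (b ℚ.- d)) (ℚₚ.∣p*q∣≡∣p∣*∣q∣ (a ℚ.- c) d) ⟩
    ℚ.∣ a ∣ ℚ.* ℚ.∣ b ℚ.- d ∣ ℚ.+ ℚ.∣ a ℚ.- c ∣ ℚ.* ℚ.∣ d ∣ ∎

  cancel-½ : ∀ {p q} → ι 2 ℚ.* p ℚ.≤ q → p ℚ.≤ ½ ℚ.* q
  cancel-½ {p} {q} 2p≤q = begin
    p                    ≡⟨ sym (ℚₚ.*-identityˡ p) ⟩
    (½ ℚ.* ι 2) ℚ.* p    ≡⟨ ℚₚ.*-assoc ½ (ι 2) p ⟩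
    ½ ℚ.* (ι 2 ℚ.* p)    ≤⟨ ℚₚ.*-monoˡ-≤-nonNeg ½ 2p≤q ⟩
    ½ ℚ.* q              ∎

module Real where

  open RationalLemmas

  Cauchy : (ℕ → ℚ) → Set
  Cauchy x = ∀ ε → 0ℚ ℚ.< ε →
    ∃[ N ] (∀ m n → N ℕ.≤ m → N ℕ.≤ n → ℚ.∣ x m ℚ.- x n ∣ ℚ.≤ ε)

  -- Two Cauchy sequences represent the same real number when each is ≤ the
  -- other; _≡_ on this record is finer than equality of real numbers.
  record ℝ : Set where
    no-eta-equality
    field
      seq    : ℕ → ℚ
      cauchy : Cauchy seq

  open ℝ public

  CauchyUpTo : ℚ → (ℕ → ℚ) → Set
  CauchyUpTo C x = ∀ δ → 0ℚ ℚ.< δ →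
    ∃[ N ] (∀ m n → N ℕ.≤ m → N ℕ.≤ n → ℚ.∣ x m ℚ.- x n ∣ ℚ.≤ C ℚ.* δ)

  cauchy-up-to : ∀ x C → 0ℚ ℚ.< C → CauchyUpTo C x → Cauchy x
  cauchy-up-to x C 0<C h ε 0<ε =
    proj₁ h′ , λ m n N≤m N≤n →
      subst (ℚ.∣ x m ℚ.- x n ∣ ℚ.≤_) Cδ≡ε (proj₂ h′ m n N≤m N≤n)
    where
    1/C : ℚ
    1/C = (ℚ.1/ C) {{ℚ.>-nonZero 0<C}}
    δ : ℚ
    δ = 1/C ℚ.* ε
    h′ = h δ (0<* (0<1/ 0<C) 0<ε)
    Cδ≡ε : C ℚ.* δ ≡ ε
    Cδ≡ε = trans (sym (ℚₚ.*-assoc C 1/C ε))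
      (trans (cong (ℚ._* ε) (ℚₚ.*-inverseʳ C {{ℚ.>-nonZero 0<C}}))
        (ℚₚ.*-identityˡ ε))

  bounded : ∀ x → Cauchy x →
    ∃₂ λ b N → ∀ n → N ℕ.≤ n → ℚ.∣ x n ∣ ℚ.≤ ι b
  bounded x c with c 1ℚ (ℚₚ.positive⁻¹ 1ℚ)
  ... | N , h = bound B , N , λ n N≤n → ℚₚ.≤-trans (lemma n N≤n) (≤bound B)
    where
    open ℚₚ.≤-Reasoning
    open +-*-Solver using (solve; _:+_; _:-_; _:=_)
    B : ℚ
    B = 1ℚ ℚ.+ ℚ.∣ x N ∣
    lemma : ∀ n → N ℕ.≤ n → ℚ.∣ x n ∣ ℚ.≤ B
    lemma n N≤n = begin
      ℚ.∣ x n ∣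
        ≡⟨ cong ℚ.∣_∣ (solve 2 (λ a b → a := (a :- b) :+ b) refl (x n) (x N)) ⟩
      ℚ.∣ (x n ℚ.- x N) ℚ.+ x N ∣
        ≤⟨ ℚₚ.∣p+q∣≤∣p∣+∣q∣ (x n ℚ.- x N) (x N) ⟩
      ℚ.∣ x n ℚ.- x N ∣ ℚ.+ ℚ.∣ x N ∣
        ≤⟨ ℚₚ.+-monoˡ-≤ ℚ.∣ x N ∣ (h n N N≤n ℕₚ.≤-refl) ⟩
      B ∎

  ≤-⊔ˡ : ∀ {a b n} → a ℕ.⊔ b ℕ.≤ n → a ℕ.≤ n
  ≤-⊔ˡ {a} {b} = ℕₚ.m⊔n≤o⇒m≤o a b

  ≤-⊔ʳ : ∀ {a b n} → a ℕ.⊔ b ℕ.≤ n → b ℕ.≤ n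
  ≤-⊔ʳ {a} {b} = ℕₚ.m⊔n≤o⇒n≤o a b

  0<ι : ∀ b → 0ℚ ℚ.< ι (suc b)
  0<ι b = ℚₚ.positive⁻¹ _ {{ℚₚ.normalize-pos (suc b) 1}}

  infix 4 _<_ _≤_
  infix 8 -_
  infixl 6 _+_ _-_
  infixl 7 _*_

  _<_ : ℝ → ℝ → Set
  x < y = ∃[ ε ] (0ℚ ℚ.< ε × ∃[ N ] (∀ n → N ℕ.≤ n → seq x n ℚ.+ ε ℚ.≤ seq y n))

  _≤_ : ℝ → ℝ → Set
  x ≤ y = ¬ (y < x)

  fromℚ : ℚ → ℝ
  seq    (fromℚ q) _ = q
  cauchy (fromℚ q) ε 0<ε = 0 , λ _ _ _ _ →
    subst (ℚ._≤ ε) (sym (cong ℚ.∣_∣ (ℚₚ.+-inverseʳ q))) (ℚₚ.<⇒≤ 0<ε)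

  fromℕ : ℕ → ℝ
  fromℕ n = fromℚ (+ n ℚ./ 1)

  0ℝ 1ℝ : ℝ
  0ℝ = fromℚ 0ℚ
  1ℝ = fromℚ 1ℚ

  0<fromℕ : ∀ n .{{_ : ℕ.NonZero n}} → 0ℝ < fromℕ n
  0<fromℕ (suc n) = ι (suc n) , 0<ι n , 0 , λ _ _ →
    ℚₚ.≤-reflexive (ℚₚ.+-identityˡ (ι (suc n)))

  _+_ : ℝ → ℝ → ℝ
  seq    (x + y) n = seq x n ℚ.+ seq y n
  cauchy (x + y) = cauchy-up-to z (ι 2) (0<ι 1) prf
    where
    z : ℕ → ℚ
    z n = seq x n ℚ.+ seq y n
    open ℚₚ.≤-Reasoning
    open +-*-Solver using (solve; _:+_; _:-_; _:*_; _:=_; con)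
    prf : CauchyUpTo (ι 2) z
    prf δ 0<δ = Nx ℕ.⊔ Ny , λ m n N≤m N≤n → begin
      ℚ.∣ (seq x m ℚ.+ seq y m) ℚ.- (seq x n ℚ.+ seq y n) ∣
        ≡⟨ cong ℚ.∣_∣ (solve 4 (λ a b c d → (a :+ b) :- (c :+ d) := (a :- c) :+ (b :- d))
             refl (seq x m) (seq y m) (seq x n) (seq y n)) ⟩
      ℚ.∣ (seq x m ℚ.- seq x n) ℚ.+ (seq y m ℚ.- seq y n) ∣
        ≤⟨ ℚₚ.∣p+q∣≤∣p∣+∣q∣ (seq x m ℚ.- seq x n) (seq y m ℚ.- seq y n) ⟩
      ℚ.∣ seq x m ℚ.- seq x n ∣ ℚ.+ ℚ.∣ seq y m ℚ.- seq y n ∣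
        ≤⟨ ℚₚ.+-mono-≤
             (proj₂ cx m n (≤-⊔ˡ {Nx} {Ny} N≤m) (≤-⊔ˡ {Nx} {Ny} N≤n))
             (proj₂ cy m n (≤-⊔ʳ {Nx} {Ny} N≤m) (≤-⊔ʳ {Nx} {Ny} N≤n)) ⟩
      δ ℚ.+ δ
        ≡⟨ solve 1 (λ d → d :+ d := con (ι 2) :* d) refl δ ⟩
      ι 2 ℚ.* δ ∎
      where
      cx = cauchy x δ 0<δ
      cy = cauchy y δ 0<δ
      Nx = proj₁ cx
      Ny = proj₁ cy

  -_ : ℝ → ℝ
  seq    (- x) n = ℚ.- seq x n
  cauchy (- x) ε 0<ε =
    proj₁ (cauchy x ε 0<ε) , λ m n N≤m N≤n →
      subst (ℚ._≤ ε) (eq m n) (proj₂ (cauchy x ε 0<ε) m n N≤m N≤n)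
    where
    open +-*-Solver using (solve; :-_; _:-_; _:=_)
    eq : ∀ m n → ℚ.∣ seq x m ℚ.- seq x n ∣ ≡ ℚ.∣ (ℚ.- seq x m) ℚ.- (ℚ.- seq x n) ∣
    eq m n = trans (∣-∣-swap (seq x m) (seq x n)) (cong ℚ.∣_∣
      (solve 2 (λ a b → b :- a := (:- a) :- (:- b)) refl (seq x m) (seq x n)))

  _-_ : ℝ → ℝ → ℝ
  x - y = x + (- y)

  _*_ : ℝ → ℝ → ℝ
  seq    (x * y) n = seq x n ℚ.* seq y n
  cauchy (x * y) = cauchy-up-to z C 0<C prf
    where
    z : ℕ → ℚ
    z n = seq x n ℚ.* seq y n
    open ℚₚ.≤-Reasoning
    open +-*-Solver using (solve; _:+_; _:*_; _:=_; con)
    bx = bounded (seq x) (cauchy x)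
    by = bounded (seq y) (cauchy y)
    X Y C : ℚ
    X = ι (proj₁ bx)
    Y = ι (proj₁ by)
    C = 1ℚ ℚ.+ (X ℚ.+ Y)
    0≤X+Y : 0ℚ ℚ.≤ X ℚ.+ Y
    0≤X+Y = ℚₚ.≤-trans (0≤ι (proj₁ bx)) (≤+ (0≤ι (proj₁ by)))
    0<C : 0ℚ ℚ.< C
    0<C = ℚₚ.<-≤-trans (ℚₚ.positive⁻¹ 1ℚ) (≤+ 0≤X+Y)
    prf : CauchyUpTo C z
    prf δ 0<δ = N , λ m n N≤m N≤n → begin
      ℚ.∣ seq x m ℚ.* seq y m ℚ.- seq x n ℚ.* seq y n ∣
        ≤⟨ ∣*-*∣≤ (seq x m) (seq y m) (seq x n) (seq y n) ⟩
      ℚ.∣ seq x m ∣ ℚ.* ℚ.∣ seq y m ℚ.- seq y n ∣ ℚ.+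
      ℚ.∣ seq x m ℚ.- seq x n ∣ ℚ.* ℚ.∣ seq y n ∣
        ≤⟨ ℚₚ.+-mono-≤
             (*-mono (ℚₚ.0≤∣p∣ (seq y m ℚ.- seq y n)) (0≤ι (proj₁ bx))
               (proj₂ (proj₂ bx) m (≤-⊔ˡ {Bx} {By} (≤-⊔ʳ {Nc} {Nb} N≤m)))
               (proj₂ cy m n (≤-⊔ʳ {Nx} {Ny} (≤-⊔ˡ {Nc} {Nb} N≤m))
                             (≤-⊔ʳ {Nx} {Ny} (≤-⊔ˡ {Nc} {Nb} N≤n))))
             (*-mono (ℚₚ.0≤∣p∣ (seq y n)) (ℚₚ.<⇒≤ 0<δ)
               (proj₂ cx m n (≤-⊔ˡ {Nx} {Ny} (≤-⊔ˡ {Nc} {Nb} N≤m))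
                             (≤-⊔ˡ {Nx} {Ny} (≤-⊔ˡ {Nc} {Nb} N≤n)))
               (proj₂ (proj₂ by) n (≤-⊔ʳ {Bx} {By} (≤-⊔ʳ {Nc} {Nb} N≤n)))) ⟩
      X ℚ.* δ ℚ.+ δ ℚ.* Y
        ≤⟨ ≤+ (ℚₚ.<⇒≤ 0<δ) ⟩
      X ℚ.* δ ℚ.+ δ ℚ.* Y ℚ.+ δ
        ≡⟨ solve 3 (λ a b d → a :* d :+ d :* b :+ d := (con 1ℚ :+ (a :+ b)) :* d)
             refl X Y δ ⟩
      C ℚ.* δ ∎
      where
      cx = cauchy x δ 0<δ
      cy = cauchy y δ 0<δ
      Nx = proj₁ cx
      Ny = proj₁ cy
      Bx = proj₁ (proj₂ bx)
      By = proj₁ (proj₂ by)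
      Nc = Nx ℕ.⊔ Ny
      Nb = Bx ℕ.⊔ By
      N = Nc ℕ.⊔ Nb

  tail≥ : ∀ {x ε N} → (∀ n → N ℕ.≤ n → 0ℚ ℚ.+ ε ℚ.≤ seq x n) →
          ∀ n → ε ℚ.≤ seq x (N ℕ.+ n)
  tail≥ {x} {ε} {N} ε≤x n = subst (ℚ._≤ seq x (N ℕ.+ n)) (ℚₚ.+-identityˡ ε)
    (ε≤x (N ℕ.+ n) (ℕₚ.m≤m+n N n))

  -- The first entries of a sequence denoting a positive real may vanish,
  -- so the reciprocal is taken only from the index N onwards beyond which
  -- the entries are bounded away from 0.
  recip : ∀ x → 0ℝ < x → ℝ
  seq    (recip x (ε , 0<ε , N , ε≤x)) n =
    (ℚ.1/ seq x (N ℕ.+ n)) {{ℚ.>-nonZero (ℚₚ.<-≤-trans 0<ε (tail≥ {x} ε≤x n))}}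
  cauchy (recip x (ε , 0<ε , N , ε≤x)) =
    cauchy-up-to b (E ℚ.* E) (0<* (0<1/ 0<ε) (0<1/ 0<ε)) prf
    where
    open ℚₚ.≤-Reasoning
    open +-*-Solver using (solve; _:+_; _:-_; _:*_; _:=_; con)
    a : ℕ → ℚ
    a n = seq x (N ℕ.+ n)
    ε≤a : ∀ n → ε ℚ.≤ a n
    ε≤a = tail≥ {x} ε≤x
    0<a : ∀ n → 0ℚ ℚ.< a n
    0<a n = ℚₚ.<-≤-trans 0<ε (ε≤a n)
    nonZero : ∀ n → ℚ.NonZero (a n)
    nonZero n = ℚ.>-nonZero (0<a n)
    E : ℚ
    E = (ℚ.1/ ε) {{ℚ.>-nonZero 0<ε}}
    b : ℕ → ℚ
    b n = (ℚ.1/ a n) {{nonZero n}}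
    0≤b : ∀ n → 0ℚ ℚ.≤ b n
    0≤b n = ℚₚ.<⇒≤ (0<1/ (0<a n))
    0≤E : 0ℚ ℚ.≤ E
    0≤E = ℚₚ.<⇒≤ (0<1/ 0<ε)
    ab≡1 : ∀ n → a n ℚ.* b n ≡ 1ℚ
    ab≡1 n = ℚₚ.*-inverseʳ (a n) {{nonZero n}}
    b≤E : ∀ n → b n ℚ.≤ E
    b≤E n = begin
      b n                  ≡⟨ sym (ℚₚ.*-identityˡ (b n)) ⟩
      1ℚ ℚ.* b n           ≡⟨ cong (ℚ._* b n) (sym (ℚₚ.*-inverseˡ ε {{ℚ.>-nonZero 0<ε}})) ⟩
      (E ℚ.* ε) ℚ.* b n    ≤⟨ *-monoʳ (0≤b n) (*-monoˡ 0≤E (ε≤a n)) ⟩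
      (E ℚ.* a n) ℚ.* b n  ≡⟨ ℚₚ.*-assoc E (a n) (b n) ⟩
      E ℚ.* (a n ℚ.* b n)  ≡⟨ cong (E ℚ.*_) (ab≡1 n) ⟩
      E ℚ.* 1ℚ             ≡⟨ ℚₚ.*-identityʳ E ⟩
      E ∎
    diff : ∀ m n → b m ℚ.- b n ≡ (b m ℚ.* b n) ℚ.* (a n ℚ.- a m)
    diff m n = begin-equality
      b m ℚ.- b n
        ≡⟨ sym (cong₂ ℚ._-_ (ℚₚ.*-identityʳ (b m)) (ℚₚ.*-identityʳ (b n))) ⟩
      b m ℚ.* 1ℚ ℚ.- b n ℚ.* 1ℚ
        ≡⟨ sym (cong₂ (λ u v → b m ℚ.* u ℚ.- b n ℚ.* v) (ab≡1 n) (ab≡1 m)) ⟩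
      b m ℚ.* (a n ℚ.* b n) ℚ.- b n ℚ.* (a m ℚ.* b m)
        ≡⟨ solve 4 (λ a b c d → b :* (c :* d) :- d :* (a :* b) := (b :* d) :* (c :- a))
             refl (a m) (b m) (a n) (b n) ⟩
      (b m ℚ.* b n) ℚ.* (a n ℚ.- a m) ∎
    prf : CauchyUpTo (E ℚ.* E) b
    prf δ 0<δ with cauchy x δ 0<δ
    ... | M , h = M , λ m n M≤m M≤n → begin
      ℚ.∣ b m ℚ.- b n ∣
        ≡⟨ cong ℚ.∣_∣ (diff m n) ⟩
      ℚ.∣ (b m ℚ.* b n) ℚ.* (a n ℚ.- a m) ∣
        ≡⟨ ℚₚ.∣p*q∣≡∣p∣*∣q∣ (b m ℚ.* b n) (a n ℚ.- a m) ⟩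
      ℚ.∣ b m ℚ.* b n ∣ ℚ.* ℚ.∣ a n ℚ.- a m ∣
        ≡⟨ cong (ℚ._* ℚ.∣ a n ℚ.- a m ∣) (ℚₚ.0≤p⇒∣p∣≡p (0≤* (0≤b m) (0≤b n))) ⟩
      (b m ℚ.* b n) ℚ.* ℚ.∣ a n ℚ.- a m ∣
        ≤⟨ *-mono (ℚₚ.0≤∣p∣ (a n ℚ.- a m)) (0≤* 0≤E 0≤E)
             (*-mono (0≤b n) 0≤E (b≤E m) (b≤E n))
             (h (N ℕ.+ n) (N ℕ.+ m)
               (ℕₚ.≤-trans M≤n (ℕₚ.m≤n+m n N)) (ℕₚ.≤-trans M≤m (ℕₚ.m≤n+m m N))) ⟩
      (E ℚ.* E) ℚ.* δ ∎

  div : (x y : ℝ) → 0ℝ < y → ℝ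
  div x y 0<y = x * recip y 0<y

  -- expTerm q k = qᵏ / k!
  expTerm : ℚ → ℕ → ℚ
  expTerm q zero    = 1ℚ
  expTerm q (suc k) = expTerm q k ℚ.* q ℚ.* (+ 1 ℚ./ suc k)

  expSum : ℚ → ℕ → ℚ
  expSum q zero    = expTerm q zero
  expSum q (suc n) = expSum q n ℚ.+ expTerm q (suc n)

  module ExpCauchy where
    open ℚₚ.≤-Reasoning
    open +-*-Solver using (solve; _:+_; _:-_; _:*_; _:=_; con)

    0≤inv : ∀ k → 0ℚ ℚ.≤ inv k
    0≤inv k = ℚₚ.<⇒≤ (0<inv k)

    ∣inv∣ : ∀ k → ℚ.∣ inv k ∣ ≡ inv k
    ∣inv∣ k = ℚₚ.0≤p⇒∣p∣≡p (0≤inv k)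

    0≤term : ∀ {B} → 0ℚ ℚ.≤ B → ∀ k → 0ℚ ℚ.≤ expTerm B k
    0≤term 0≤B zero    = ℚₚ.nonNegative⁻¹ 1ℚ
    0≤term 0≤B (suc k) = 0≤* (0≤* (0≤term 0≤B k) 0≤B) (0≤inv k)

    ∣term∣≤ : ∀ {q B} → ℚ.∣ q ∣ ℚ.≤ B → ∀ k → ℚ.∣ expTerm q k ∣ ℚ.≤ expTerm B k
    ∣term∣≤ q≤B zero = ℚₚ.≤-refl
    ∣term∣≤ {q} {B} q≤B (suc k) = begin
      ℚ.∣ expTerm q k ℚ.* q ℚ.* inv k ∣
        ≡⟨ ℚₚ.∣p*q∣≡∣p∣*∣q∣ (expTerm q k ℚ.* q) (inv k) ⟩
      ℚ.∣ expTerm q k ℚ.* q ∣ ℚ.* ℚ.∣ inv k ∣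
        ≡⟨ cong₂ ℚ._*_ (ℚₚ.∣p*q∣≡∣p∣*∣q∣ (expTerm q k) q) (∣inv∣ k) ⟩
      ℚ.∣ expTerm q k ∣ ℚ.* ℚ.∣ q ∣ ℚ.* inv k
        ≤⟨ *-monoʳ (0≤inv k)
             (*-mono (ℚₚ.0≤∣p∣ q) (0≤term 0≤B k) (∣term∣≤ q≤B k) q≤B) ⟩
      expTerm B k ℚ.* B ℚ.* inv k ∎
      where
      0≤B : 0ℚ ℚ.≤ B
      0≤B = ℚₚ.≤-trans (ℚₚ.0≤∣p∣ q) q≤B

    term-lipschitz : ∀ {p q B} → ℚ.∣ p ∣ ℚ.≤ B → ℚ.∣ q ∣ ℚ.≤ B → ∀ k →
      ℚ.∣ expTerm p (suc k) ℚ.- expTerm q (suc k) ∣ ℚ.≤ ℚ.∣ p ℚ.- q ∣ ℚ.* expTerm B k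
    term-lipschitz {p} {q} {B} p≤B q≤B k = begin
      ℚ.∣ P k ℚ.* p ℚ.* inv k ℚ.- Q k ℚ.* q ℚ.* inv k ∣
        ≡⟨ cong ℚ.∣_∣ (solve 3 (λ a b i → a :* i :- b :* i := (a :- b) :* i)
             refl (P k ℚ.* p) (Q k ℚ.* q) (inv k)) ⟩
      ℚ.∣ (P k ℚ.* p ℚ.- Q k ℚ.* q) ℚ.* inv k ∣
        ≡⟨ ℚₚ.∣p*q∣≡∣p∣*∣q∣ (P k ℚ.* p ℚ.- Q k ℚ.* q) (inv k) ⟩
      ℚ.∣ P k ℚ.* p ℚ.- Q k ℚ.* q ∣ ℚ.* ℚ.∣ inv k ∣
        ≡⟨ cong (ℚ.∣ P k ℚ.* p ℚ.- Q k ℚ.* q ∣ ℚ.*_) (∣inv∣ k) ⟩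
      ℚ.∣ P k ℚ.* p ℚ.- Q k ℚ.* q ∣ ℚ.* inv k
        ≤⟨ *-monoʳ (0≤inv k) (∣*-*∣≤ (P k) p (Q k) q) ⟩
      (ℚ.∣ P k ∣ ℚ.* D ℚ.+ ℚ.∣ P k ℚ.- Q k ∣ ℚ.* ℚ.∣ q ∣) ℚ.* inv k
        ≤⟨ *-monoʳ (0≤inv k) (ℚₚ.+-mono-≤
             (*-monoʳ 0≤D (∣term∣≤ p≤B k)) (prev k)) ⟩
      (T k ℚ.* D ℚ.+ D ℚ.* (ι k ℚ.* T k)) ℚ.* inv k
        ≡⟨ solve 4 (λ t d j i → (t :* d :+ d :* (j :* t)) :* i := (d :* t) :* ((con 1ℚ :+ j) :* i))
             refl (T k) D (ι k) (inv k) ⟩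
      (D ℚ.* T k) ℚ.* ((1ℚ ℚ.+ ι k) ℚ.* inv k)
        ≡⟨ cong (λ z → (D ℚ.* T k) ℚ.* (z ℚ.* inv k)) (sym (ι-suc k)) ⟩
      (D ℚ.* T k) ℚ.* (ι (suc k) ℚ.* inv k)
        ≡⟨ cong ((D ℚ.* T k) ℚ.*_) (ι*inv k) ⟩
      (D ℚ.* T k) ℚ.* 1ℚ
        ≡⟨ ℚₚ.*-identityʳ (D ℚ.* T k) ⟩
      D ℚ.* T k ∎
      where
      D = ℚ.∣ p ℚ.- q ∣
      P = expTerm p
      Q = expTerm q
      T = expTerm B
      0≤D : 0ℚ ℚ.≤ D
      0≤D = ℚₚ.0≤∣p∣ (p ℚ.- q)
      0≤B : 0ℚ ℚ.≤ B
      0≤B = ℚₚ.≤-trans (ℚₚ.0≤∣p∣ q) q≤B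
      prev : ∀ k → ℚ.∣ P k ℚ.- Q k ∣ ℚ.* ℚ.∣ q ∣ ℚ.≤ D ℚ.* (ι k ℚ.* T k)
      prev zero = ℚₚ.≤-reflexive
        (trans (ℚₚ.*-zeroˡ ℚ.∣ q ∣) (sym (ℚₚ.*-zeroʳ D)))
      prev (suc j) = begin
        ℚ.∣ P (suc j) ℚ.- Q (suc j) ∣ ℚ.* ℚ.∣ q ∣
          ≤⟨ *-mono (ℚₚ.0≤∣p∣ q) (0≤* 0≤D (0≤term 0≤B j))
               (term-lipschitz p≤B q≤B j) q≤B ⟩
        (D ℚ.* T j) ℚ.* B
          ≡⟨ sym (ℚₚ.*-identityʳ ((D ℚ.* T j) ℚ.* B)) ⟩
        ((D ℚ.* T j) ℚ.* B) ℚ.* 1ℚ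
          ≡⟨ cong (((D ℚ.* T j) ℚ.* B) ℚ.*_) (sym (ι*inv j)) ⟩
        ((D ℚ.* T j) ℚ.* B) ℚ.* (ι (suc j) ℚ.* inv j)
          ≡⟨ solve 5 (λ d t b n i → ((d :* t) :* b) :* (n :* i) := d :* (n :* (t :* b :* i)))
               refl D (T j) B (ι (suc j)) (inv j) ⟩
        D ℚ.* (ι (suc j) ℚ.* T (suc j)) ∎

    sum-lipschitz : ∀ {p q B} → ℚ.∣ p ∣ ℚ.≤ B → ℚ.∣ q ∣ ℚ.≤ B → ∀ n →
      ℚ.∣ expSum p n ℚ.- expSum q n ∣ ℚ.≤ ℚ.∣ p ℚ.- q ∣ ℚ.* expSum B n
    sum-lipschitz {p} {q} {B} p≤B q≤B zero = 0≤* (ℚₚ.0≤∣p∣ (p ℚ.- q)) (ℚₚ.nonNegative⁻¹ 1ℚ)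
    sum-lipschitz {p} {q} {B} p≤B q≤B (suc n) = begin
      ℚ.∣ expSum p (suc n) ℚ.- expSum q (suc n) ∣
        ≤⟨ go (suc n) ⟩
      ℚ.∣ p ℚ.- q ∣ ℚ.* expSum B n
        ≤⟨ *-monoˡ (ℚₚ.0≤∣p∣ (p ℚ.- q)) (≤+ (0≤term 0≤B (suc n))) ⟩
      ℚ.∣ p ℚ.- q ∣ ℚ.* expSum B (suc n) ∎
      where
      0≤B : 0ℚ ℚ.≤ B
      0≤B = ℚₚ.≤-trans (ℚₚ.0≤∣p∣ q) q≤B
      go : ∀ m → ℚ.∣ expSum p m ℚ.- expSum q m ∣ ℚ.≤ ℚ.∣ p ℚ.- q ∣ ℚ.* expSum B (ℕ.pred m)
      go zero = sum-lipschitz p≤B q≤B zero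
      go (suc zero) = begin
        ℚ.∣ (1ℚ ℚ.+ expTerm p 1) ℚ.- (1ℚ ℚ.+ expTerm q 1) ∣
          ≡⟨ cong ℚ.∣_∣ (solve 2 (λ a b → (con 1ℚ :+ a) :- (con 1ℚ :+ b) := a :- b)
               refl (expTerm p 1) (expTerm q 1)) ⟩
        ℚ.∣ expTerm p 1 ℚ.- expTerm q 1 ∣
          ≤⟨ term-lipschitz p≤B q≤B 0 ⟩
        ℚ.∣ p ℚ.- q ∣ ℚ.* 1ℚ ∎
      go (suc (suc m)) = begin
        ℚ.∣ (expSum p (suc m) ℚ.+ expTerm p (2 ℕ.+ m)) ℚ.- (expSum q (suc m) ℚ.+ expTerm q (2 ℕ.+ m)) ∣
          ≡⟨ cong ℚ.∣_∣ (solve 4 (λ a b c d → (a :+ b) :- (c :+ d) := (a :- c) :+ (b :- d))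
               refl (expSum p (suc m)) (expTerm p (2 ℕ.+ m)) (expSum q (suc m)) (expTerm q (2 ℕ.+ m))) ⟩
        ℚ.∣ (expSum p (suc m) ℚ.- expSum q (suc m)) ℚ.+ (expTerm p (2 ℕ.+ m) ℚ.- expTerm q (2 ℕ.+ m)) ∣
          ≤⟨ ℚₚ.∣p+q∣≤∣p∣+∣q∣ (expSum p (suc m) ℚ.- expSum q (suc m)) (expTerm p (2 ℕ.+ m) ℚ.- expTerm q (2 ℕ.+ m)) ⟩
        ℚ.∣ expSum p (suc m) ℚ.- expSum q (suc m) ∣ ℚ.+ ℚ.∣ expTerm p (2 ℕ.+ m) ℚ.- expTerm q (2 ℕ.+ m) ∣
          ≤⟨ ℚₚ.+-mono-≤ (go (suc m)) (term-lipschitz p≤B q≤B (suc m)) ⟩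
        ℚ.∣ p ℚ.- q ∣ ℚ.* expSum B m ℚ.+ ℚ.∣ p ℚ.- q ∣ ℚ.* expTerm B (suc m)
          ≡⟨ sym (ℚₚ.*-distribˡ-+ ℚ.∣ p ℚ.- q ∣ (expSum B m) (expTerm B (suc m))) ⟩
        ℚ.∣ p ℚ.- q ∣ ℚ.* expSum B (suc m) ∎

    sum-tail : ∀ {q B} → ℚ.∣ q ∣ ℚ.≤ B → ∀ n j →
      ℚ.∣ expSum q (j ℕ.+ n) ℚ.- expSum q n ∣ ℚ.≤ expSum B (j ℕ.+ n) ℚ.- expSum B n
    sum-tail {q} {B} q≤B n zero = ℚₚ.≤-reflexive
      (trans (cong ℚ.∣_∣ (ℚₚ.+-inverseʳ (expSum q n))) (sym (ℚₚ.+-inverseʳ (expSum B n))))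
    sum-tail {q} {B} q≤B n (suc j) = begin
      ℚ.∣ (s ℚ.+ t) ℚ.- expSum q n ∣
        ≡⟨ cong ℚ.∣_∣ (solve 3 (λ s t u → (s :+ t) :- u := (s :- u) :+ t) refl s t (expSum q n)) ⟩
      ℚ.∣ (s ℚ.- expSum q n) ℚ.+ t ∣
        ≤⟨ ℚₚ.∣p+q∣≤∣p∣+∣q∣ (s ℚ.- expSum q n) t ⟩
      ℚ.∣ s ℚ.- expSum q n ∣ ℚ.+ ℚ.∣ t ∣
        ≤⟨ ℚₚ.+-mono-≤ (sum-tail q≤B n j) (∣term∣≤ q≤B (suc (j ℕ.+ n))) ⟩
      (S ℚ.- expSum B n) ℚ.+ T
        ≡⟨ solve 3 (λ s t u → (s :- u) :+ t := (s :+ t) :- u) refl S T (expSum B n) ⟩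
      (S ℚ.+ T) ℚ.- expSum B n ∎
      where
      s = expSum q (j ℕ.+ n)
      t = expTerm q (suc (j ℕ.+ n))
      S = expSum B (j ℕ.+ n)
      T = expTerm B (suc (j ℕ.+ n))

    -- From index 2b on, consecutive terms of Σ bᵏ/k! at least halve.
    module _ (b : ℕ) where

      B = ι b
      K = b ℕ.+ b
      T = expTerm B
      S = expSum B

      ratio : ∀ k → K ℕ.≤ k → B ℚ.* inv k ℚ.≤ ½
      ratio k K≤k = begin
        B ℚ.* inv k                    ≤⟨ cancel-½ (begin
          ι 2 ℚ.* (B ℚ.* inv k)        ≡⟨ solve 2 (λ b i → con (ι 2) :* (b :* i) := (b :+ b) :* i) refl B (inv k) ⟩
          (B ℚ.+ B) ℚ.* inv k          ≡⟨ cong (ℚ._* inv k) (ι-+ b b) ⟩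
          ι K ℚ.* inv k                ≤⟨ *-monoʳ (0≤inv k) (ι-mono (ℕₚ.m≤n⇒m≤1+n K≤k)) ⟩
          ι (suc k) ℚ.* inv k          ≡⟨ ι*inv k ⟩
          1ℚ                           ∎) ⟩
        ½ ℚ.* 1ℚ                       ≡⟨ ℚₚ.*-identityʳ ½ ⟩
        ½ ∎
        where
        ι-+ : ∀ m n → ι m ℚ.+ ι n ≡ ι (m ℕ.+ n)
        ι-+ zero n = ℚₚ.+-identityˡ (ι n)
        ι-+ (suc m) n = trans (cong (ℚ._+ ι n) (ι-suc m))
          (trans (ℚₚ.+-assoc 1ℚ (ι m) (ι n))
          (trans (cong (1ℚ ℚ.+_) (ι-+ m n)) (sym (ι-suc (m ℕ.+ n)))))

      halve : ∀ k → K ℕ.≤ k → T (suc k) ℚ.≤ T k ℚ.* ½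
      halve k K≤k = begin
        T k ℚ.* B ℚ.* inv k    ≡⟨ ℚₚ.*-assoc (T k) B (inv k) ⟩
        T k ℚ.* (B ℚ.* inv k)  ≤⟨ *-monoˡ (0≤term (0≤ι b) k) (ratio k K≤k) ⟩
        T k ℚ.* ½              ∎

      descend : ∀ n j → K ℕ.≤ n → S (j ℕ.+ n) ℚ.+ T (j ℕ.+ n) ℚ.≤ S n ℚ.+ T n
      descend n zero K≤n = ℚₚ.≤-refl
      descend n (suc j) K≤n = begin
        (S m ℚ.+ T (suc m)) ℚ.+ T (suc m)
          ≤⟨ ℚₚ.+-mono-≤ (ℚₚ.+-monoʳ-≤ (S m) h) h ⟩
        (S m ℚ.+ T m ℚ.* ½) ℚ.+ T m ℚ.* ½
          ≡⟨ solve 2 (λ s t → (s :+ t :* con ½) :+ t :* con ½ := s :+ t) refl (S m) (T m) ⟩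
        S m ℚ.+ T m
          ≤⟨ descend n j K≤n ⟩
        S n ℚ.+ T n ∎
        where
        m = j ℕ.+ n
        h = halve m (ℕₚ.≤-trans K≤n (ℕₚ.m≤n+m n j))

      sum≤ : ∀ n j → K ℕ.≤ n → S (j ℕ.+ n) ℚ.≤ S n ℚ.+ T n
      sum≤ n j K≤n = ℚₚ.≤-trans (≤+ (0≤term (0≤ι b) (j ℕ.+ n))) (descend n j K≤n)

      tail≤ : ∀ n j → K ℕ.≤ n → S (j ℕ.+ n) ℚ.- S n ℚ.≤ T n
      tail≤ n j K≤n = begin
        S (j ℕ.+ n) ℚ.- S n      ≤⟨ ℚₚ.+-monoˡ-≤ (ℚ.- S n) (sum≤ n j K≤n) ⟩
        (S n ℚ.+ T n) ℚ.- S n    ≡⟨ solve 2 (λ s t → (s :+ t) :- s := t) refl (S n) (T n) ⟩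
        T n ∎

      decay : ∀ j → ι (suc j) ℚ.* T (j ℕ.+ K) ℚ.≤ T K
      decay zero = ℚₚ.≤-reflexive (ℚₚ.*-identityˡ (T K))
      decay (suc j) = begin
        ι (2 ℕ.+ j) ℚ.* T (suc j ℕ.+ K)
          ≤⟨ *-monoˡ (0≤ι (2 ℕ.+ j)) (halve (j ℕ.+ K) (ℕₚ.m≤n+m K j)) ⟩
        ι (2 ℕ.+ j) ℚ.* (T (j ℕ.+ K) ℚ.* ½)
          ≡⟨ cong (ℚ._* (T (j ℕ.+ K) ℚ.* ½))
               (trans (ι-suc (suc j)) (cong (1ℚ ℚ.+_) (ι-suc j))) ⟩
        (1ℚ ℚ.+ (1ℚ ℚ.+ ι j)) ℚ.* (T (j ℕ.+ K) ℚ.* ½)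
          ≤⟨ *-monoʳ (0≤* (0≤term (0≤ι b) (j ℕ.+ K)) (ℚₚ.nonNegative⁻¹ ½))
               (ℚₚ.≤-trans (≤+ {1ℚ ℚ.+ (1ℚ ℚ.+ ι j)} (0≤ι j)) (ℚₚ.≤-reflexive (solve 1
                 (λ i → (con 1ℚ :+ (con 1ℚ :+ i)) :+ i := con (ι 2) :* (con 1ℚ :+ i))
                 refl (ι j)))) ⟩
        (ι 2 ℚ.* (1ℚ ℚ.+ ι j)) ℚ.* (T (j ℕ.+ K) ℚ.* ½)
          ≡⟨ solve 2 (λ i t → (con (ι 2) :* (con 1ℚ :+ i)) :* (t :* con ½) := (con 1ℚ :+ i) :* t)
               refl (ι j) (T (j ℕ.+ K)) ⟩
        (1ℚ ℚ.+ ι j) ℚ.* T (j ℕ.+ K)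
          ≡⟨ cong (ℚ._* T (j ℕ.+ K)) (sym (ι-suc j)) ⟩
        ι (suc j) ℚ.* T (j ℕ.+ K)
          ≤⟨ decay j ⟩
        T K ∎

      term→0 : ∀ δ → 0ℚ ℚ.< δ → ∃[ N ] (∀ n → N ℕ.≤ n → T n ℚ.≤ δ)
      term→0 δ 0<δ = M ℕ.+ K , λ n N≤n →
        subst (λ n → T n ℚ.≤ δ) (ℕₚ.m∸n+n≡m (ℕₚ.≤-trans (ℕₚ.m≤n+m K M) N≤n))
          (small (n ℕ.∸ K) (ℕₚ.m+n≤o⇒m≤o∸n M N≤n))
        where
        1/δ : ℚ
        1/δ = (ℚ.1/ δ) {{ℚ.>-nonZero 0<δ}}
        M : ℕ
        M = bound (1/δ ℚ.* T K)
        small : ∀ j → M ℕ.≤ j → T (j ℕ.+ K) ℚ.≤ δ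
        small j M≤j = ℚₚ.*-cancelˡ-≤-pos (ι (suc j)) {{ℚ.positive (0<ι j)}} (begin
          ι (suc j) ℚ.* T (j ℕ.+ K)    ≤⟨ decay j ⟩
          T K                          ≡⟨ sym (ℚₚ.*-identityˡ (T K)) ⟩
          1ℚ ℚ.* T K                   ≡⟨ cong (ℚ._* T K) (sym (ℚₚ.*-inverseʳ δ {{ℚ.>-nonZero 0<δ}})) ⟩
          (δ ℚ.* 1/δ) ℚ.* T K          ≡⟨ ℚₚ.*-assoc δ 1/δ (T K) ⟩
          δ ℚ.* (1/δ ℚ.* T K)          ≤⟨ *-monoˡ (ℚₚ.<⇒≤ 0<δ) (≤bound (1/δ ℚ.* T K)) ⟩
          δ ℚ.* ι M                    ≤⟨ *-monoˡ (ℚₚ.<⇒≤ 0<δ) (ι-mono (ℕₚ.m≤n⇒m≤1+n M≤j)) ⟩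
          δ ℚ.* ι (suc j)              ≡⟨ ℚₚ.*-comm δ (ι (suc j)) ⟩
          ι (suc j) ℚ.* δ              ∎)

  exp : ℝ → ℝ
  seq    (exp x) n = expSum (seq x n) n
  cauchy (exp x) = cauchy-up-to z C 0<C prf
    where
    z : ℕ → ℚ
    z n = expSum (seq x n) n
    open ExpCauchy
    open ℚₚ.≤-Reasoning
    open +-*-Solver using (solve; _:+_; _:*_; _:=_; con)
    bx = bounded (seq x) (cauchy x)
    b  = proj₁ bx
    Nb = proj₁ (proj₂ bx)
    Z C : ℚ
    Z = S b (K b) ℚ.+ T b (K b)
    C = Z ℚ.+ 1ℚ
    0≤S : ∀ n → 0ℚ ℚ.≤ S b n
    0≤S zero = ℚₚ.nonNegative⁻¹ 1ℚ
    0≤S (suc n) = ℚₚ.≤-trans (0≤S n) (≤+ (0≤term (0≤ι b) (suc n)))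
    0≤Z : 0ℚ ℚ.≤ Z
    0≤Z = ℚₚ.≤-trans (0≤S (K b)) (≤+ (0≤term (0≤ι b) (K b)))
    0<C : 0ℚ ℚ.< C
    0<C = ℚₚ.<-≤-trans (ℚₚ.positive⁻¹ 1ℚ)
      (subst (ℚ._≤ C) (ℚₚ.+-identityˡ 1ℚ) (ℚₚ.+-monoˡ-≤ 1ℚ 0≤Z))
    S≤Z : ∀ n → K b ℕ.≤ n → S b n ℚ.≤ Z
    S≤Z n K≤n = subst (λ n → S b n ℚ.≤ Z) (ℕₚ.m∸n+n≡m K≤n)
      (sum≤ b (K b) (n ℕ.∸ K b) ℕₚ.≤-refl)
    prf : CauchyUpTo C z
    prf δ 0<δ = N , both
      where
      cx = cauchy x δ 0<δ
      ct = term→0 b δ 0<δ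
      N₁ = proj₁ cx ℕ.⊔ proj₁ ct
      N₂ = K b ℕ.⊔ Nb
      N = N₁ ℕ.⊔ N₂
      go : ∀ m n → N ℕ.≤ m → N ℕ.≤ n → n ℕ.≤ m →
           ℚ.∣ expSum (seq x m) m ℚ.- expSum (seq x n) n ∣ ℚ.≤ C ℚ.* δ
      go m n N≤m N≤n n≤m = begin
        ℚ.∣ expSum p m ℚ.- expSum q n ∣
          ≤⟨ ∣-∣-triangle (expSum p m) (expSum q m) (expSum q n) ⟩
        ℚ.∣ expSum p m ℚ.- expSum q m ∣ ℚ.+ ℚ.∣ expSum q m ℚ.- expSum q n ∣
          ≤⟨ ℚₚ.+-mono-≤
               (ℚₚ.≤-trans (sum-lipschitz {p} {q} (p≤ m N≤m) (p≤ n N≤n) m)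
                 (*-mono (0≤S m) (ℚₚ.<⇒≤ 0<δ)
                   (proj₂ cx m n (N≤cx N≤m) (N≤cx N≤n)) (S≤Z m (N≤K N≤m))))
               (ℚₚ.≤-trans tail
                 (proj₂ ct n (≤-⊔ʳ {proj₁ cx} (≤-⊔ˡ {N₁} {N₂} N≤n)))) ⟩
        δ ℚ.* Z ℚ.+ δ
          ≡⟨ solve 2 (λ d z → d :* z :+ d := (z :+ con 1ℚ) :* d) refl δ Z ⟩
        C ℚ.* δ ∎
        where
        p = seq x m
        q = seq x n
        p≤ : ∀ m → N ℕ.≤ m → ℚ.∣ seq x m ∣ ℚ.≤ ι b
        p≤ m N≤m = proj₂ (proj₂ bx) m (≤-⊔ʳ {K b} {Nb} (≤-⊔ʳ {N₁} {N₂} N≤m))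
        N≤cx : ∀ {m} → N ℕ.≤ m → proj₁ cx ℕ.≤ m
        N≤cx N≤m = ≤-⊔ˡ {proj₁ cx} {proj₁ ct} (≤-⊔ˡ {N₁} {N₂} N≤m)
        N≤K : ∀ {m} → N ℕ.≤ m → K b ℕ.≤ m
        N≤K N≤m = ≤-⊔ˡ {K b} {Nb} (≤-⊔ʳ {N₁} {N₂} N≤m)
        tail : ℚ.∣ expSum q m ℚ.- expSum q n ∣ ℚ.≤ T b n
        tail = subst (λ m → ℚ.∣ expSum q m ℚ.- expSum q n ∣ ℚ.≤ T b n) (ℕₚ.m∸n+n≡m n≤m)
          (ℚₚ.≤-trans (sum-tail {q} (p≤ n N≤n) n (m ℕ.∸ n))
            (tail≤ b n (m ℕ.∸ n) (N≤K N≤n)))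
      both : ∀ m n → N ℕ.≤ m → N ℕ.≤ n →
             ℚ.∣ expSum (seq x m) m ℚ.- expSum (seq x n) n ∣ ℚ.≤ C ℚ.* δ
      both m n N≤m N≤n = [ go m n N≤m N≤n , flipped ]′ (ℕₚ.≤-total n m)
        where
        flipped : m ℕ.≤ n → ℚ.∣ expSum (seq x m) m ℚ.- expSum (seq x n) n ∣ ℚ.≤ C ℚ.* δ
        flipped m≤n = ℚₚ.≤-trans
          (ℚₚ.≤-reflexive (∣-∣-swap (expSum (seq x m) m) (expSum (seq x n) n)))
          (go n m N≤n N≤m m≤n)

  sum : List ℝ → ℝ
  sum = foldr _+_ 0ℝ

open Real public

record Matroid (n : ℕ) : Set₁ where
  field
    Indep        : Subset n → Set
    empty        : Indep Subset.⊥
    hereditary   : ∀ {X Y} → X ⊆ Y → Indep Y → Indep X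
    augmentation : ∀ {X Y} → Indep X → Indep Y → Subset.∣ X ∣ ℕ.< Subset.∣ Y ∣ →
                   ∃[ e ] (e ∈ Y × e ∉ X × Indep (X ∪ ⁅ e ⁆))

open Matroid public using (Indep)

module _ {n : ℕ} where

  infixl 6 _△_

  _△_ : Subset n → Subset n → Subset n
  X △ Y = (X ─ Y) ∪ (Y ─ X)

  -- X - x + x′
  exchange : Subset n → Fin n → Fin n → Subset n
  exchange X x x′ = (X Subset.- x) ∪ ⁅ x′ ⁆

  NonNegative : (Subset n → ℝ) → Set
  NonNegative f = ∀ X → 0ℝ ≤ f X

  Monotone : (Subset n → ℝ) → Set
  Monotone f = ∀ {X Y} → X ⊆ Y → f X ≤ f Y

  occurrences : Fin n → List (Subset n) → ℕ
  occurrences e 𝒫 = length (filter (e ∈?_) 𝒫)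

  Localizable : (f : Subset n → ℝ) (α β₁ β₂ : ℝ) (s t : ℕ) → Set
  Localizable f α β₁ β₂ s t =
    0ℝ ≤ α × 0ℝ ≤ β₁ × 0ℝ ≤ β₂ ×
    (∀ (X X* : Subset n) → Subset.∣ X ∣ ℕ.≤ s → Subset.∣ X* ∣ ℕ.≤ s →
     ∀ (𝒫 : List (Subset n)) → All (λ P → P ⊆ X △ X* × Subset.∣ P ∣ ℕ.≤ t) 𝒫 →
     ∀ (k ℓ : ℕ) → 0 ℕ.< k → 0 ℕ.< ℓ →
     (∀ {e} → e ∈ X* ─ X → k ℕ.≤ occurrences e 𝒫) →
     (∀ {e} → e ∈ X ─ X* → occurrences e 𝒫 ℕ.≤ ℓ) →
     α * fromℕ k * f X* - (β₁ * fromℕ ℓ + β₂ * fromℕ k) * f X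
       ≤ sum (map (λ P → f (X △ P) - f X) 𝒫))

  module _ (M : Matroid n) where

    IsRank : ℕ → Set
    IsRank s = (∃[ X ] (Indep M X × Subset.∣ X ∣ ≡ s)) ×
               (∀ X → Indep M X → Subset.∣ X ∣ ℕ.≤ s)

    Maximal : Subset n → Set
    Maximal X = Indep M X × (∀ Y → Indep M Y → X ⊆ Y → Y ≡ X)

    -- Sets obtainable from ∅ by adding elements one at a time within Indep.
    data Grown : Subset n → Set where
      start : Grown Subset.⊥
      add   : ∀ {X e} → Grown X → e ∉ X → Indep M (X ∪ ⁅ e ⁆) → Grown (X ∪ ⁅ e ⁆)

    Exchangeable : Subset n → Fin n → Fin n → Set
    Exchangeable X x x′ = x ∈ X × x′ ∉ X × Indep M (exchange X x x′)

    module _ (f : Subset n → ℝ) where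

      Optimal : Subset n → Set
      Optimal X = Indep M X × (∀ Y → Indep M Y → f Y ≤ f X)

      Best : Subset n → Fin n → Fin n → Set
      Best X x x′ = Exchangeable X x x′ ×
        (∀ y y′ → Exchangeable X y y′ → f (exchange X y y′) ≤ f (exchange X x x′))

      Improves : Subset n → Fin n → Fin n → Set
      Improves X x x′ = 0ℝ < f (exchange X x x′) - f X

      -- After i X: X is a possible current set after i iterations, each of
      -- which performed an exchange.  The arbitrary initial additions and the
      -- ties between best pairs make this a relation, not a function.
      data After : ℕ → Subset n → Set where
        init : ∀ {X} → Grown X → Maximal X → After 0 X
        step : ∀ {i X x x′} → After i X → Best X x x′ → Improves X x x′ →
               After (suc i) (exchange X x x′)

      Stopped : ℕ → Subset n → Set
      Stopped T X = ∃[ i ] (i ℕ.< T × After i X ×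
        (∀ x x′ → Exchangeable X x x′ → ¬ Improves X x x′))

      Output : ℕ → Subset n → Set
      Output T X = After T X ⊎ Stopped T X

{-# OPTIONS --safe #-}
-- For bases X and B of the matroid, repeated symmetric exchange yields a bijection
-- between X ─ B and B ─ X all of whose pairs can be swapped in X.  Localizability
-- applied to these pairs (k = ℓ = 1) with B ⊇ X* bounds the best gain δ of a single
-- swap: α f(X*) - β f(X) ≤ s δ, where β = β₁ + β₂.  At a local optimum δ ≤ 0.  In
-- general, with a = α f(X*) / β and t = β / s, a step from X to X′ gives
-- a - f(X′) ≤ (1 - t) (a - f(X)), and (1 - t) exp t ≤ 1 makes
-- (a - f(Xᵢ)) exp (i t) ≤ a an invariant.
--
-- Independence need not be decidable, but every inequality between reals is a
-- negation, so decidability may be assumed while proving one.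
module Submission where

open import Defs
open import Data.Fin.Base using (Fin; zero; suc)
import Data.Fin.Properties as Finₚ
open import Data.Fin.Subset as Subset
  using (Subset; _∈_; _∉_; _⊆_; _⊂_; _∪_; _─_; ⁅_⁆; inside; outside)
open import Data.Fin.Subset.Induction using (⊂-wellFounded; Acc; acc)
open import Data.Fin.Subset.Properties
open import Data.List.Base using (List; []; _∷_; length; map)
open import Data.List.Properties using (filter-accept; filter-reject)
open import Data.List.Relation.Unary.All as All using (All; []; _∷_)
open import Data.Nat.Base as ℕ using (ℕ; zero; suc; NonZero)
import Data.Nat.Properties as ℕₚ
open import Data.Product.Base using (∃₂; ∃-syntax; _×_; _,_; proj₁; proj₂)
open import Data.Rational.Base as ℚ using (ℚ; 0ℚ; 1ℚ; ½)
import Data.Rational.Properties as ℚₚ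
open import Data.Rational.Solver using (module +-*-Solver)
open import Data.Sum.Base using (_⊎_; inj₁; inj₂)
open import Data.Vec.Base using ([]; _∷_; here; there)
open import Function.Base using (_∘_)
open import Relation.Binary.PropositionalEquality
open import Relation.Nullary using (¬_; Dec; yes; no; contradiction; ¬?; _×-dec_)
open import Relation.Nullary.Decidable using (decidable-stable; ¬¬-excluded-middle)

open RationalLemmas
open ExpCauchy using (0≤term; ∣term∣≤; 0≤inv; sum-tail; tail≤; term→0)

-- `a` is the value of `f X` at which the guaranteed gain of a swap vanishes, so each step shrinks
-- the distance to it. What shapes the proof is the arithmetic around this. Reals are Cauchy
-- sequences, identities are checked index by index on representatives, and everything else is a
-- one-sided inequality: `r * β ≤ 1` and `exp (x + y) ≤ exp x * exp y` suffice. The n-th entry of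
-- `exp x` is the n-th partial sum at the n-th approximant. For nonnegative arguments such sums are
-- positive and easily bounded; for negative ones they may be negative. Hence the invariant carries
-- a growing exponential as a factor instead of a decaying one, the step uses `(1 - t) * exp t ≤ 1`
-- instead of `1 - t ≤ exp (- t)`, and the negative exponent appears only at the end, through
-- `1 ≤ exp (- z) * exp z`.

-- Rational partial sums of the exponential series.

module ℚConvolution where

  open +-*-Solver using (solve; _:+_; _:-_; _:*_; _:=_; con)
  open ℚₚ.≤-Reasoning

  ι-+ : ∀ m n → ι (m ℕ.+ n) ≡ ι m ℚ.+ ι n
  ι-+ zero n = sym (ℚₚ.+-identityˡ (ι n))
  ι-+ (suc m) n = begin-equality
    ι (suc m ℕ.+ n)          ≡⟨ ι-suc (m ℕ.+ n) ⟩
    1ℚ ℚ.+ ι (m ℕ.+ n)       ≡⟨ cong (1ℚ ℚ.+_) (ι-+ m n) ⟩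
    1ℚ ℚ.+ (ι m ℚ.+ ι n)     ≡⟨ ℚₚ.+-assoc 1ℚ (ι m) (ι n) ⟨
    (1ℚ ℚ.+ ι m) ℚ.+ ι n     ≡⟨ cong (ℚ._+ ι n) (ι-suc m) ⟨
    ι (suc m) ℚ.+ ι n        ∎

  -- Coefficients of the Cauchy product. Peeling off `a 0` and shifting `a` makes the facts about it
  -- inductions on `n` for all `a` at once.
  conv : (ℕ → ℚ) → (ℕ → ℚ) → ℕ → ℚ
  conv a b zero    = a 0 ℚ.* b 0
  conv a b (suc n) = a 0 ℚ.* b (suc n) ℚ.+ conv (a ∘ ℕ.suc) b n

  -- Coefficients of the formal derivative. Through its product rule the exponential law needs no
  -- binomial coefficients.
  ∂ : (ℕ → ℚ) → ℕ → ℚ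
  ∂ a i = ι (suc i) ℚ.* a (suc i)

  conv-cong : ∀ {a a′ b b′} → (∀ i → a i ≡ a′ i) → (∀ i → b i ≡ b′ i) →
              ∀ n → conv a b n ≡ conv a′ b′ n
  conv-cong a≡ b≡ zero    = cong₂ ℚ._*_ (a≡ 0) (b≡ 0)
  conv-cong a≡ b≡ (suc n) =
    cong₂ ℚ._+_ (cong₂ ℚ._*_ (a≡ 0) (b≡ (suc n))) (conv-cong (a≡ ∘ ℕ.suc) b≡ n)

  conv-+ˡ : ∀ a a′ b n → conv (λ i → a i ℚ.+ a′ i) b n ≡ conv a b n ℚ.+ conv a′ b n
  conv-+ˡ a a′ b zero    = ℚₚ.*-distribʳ-+ (b 0) (a 0) (a′ 0)
  conv-+ˡ a a′ b (suc n) = trans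
    (cong ((a 0 ℚ.+ a′ 0) ℚ.* b (suc n) ℚ.+_) (conv-+ˡ (a ∘ ℕ.suc) (a′ ∘ ℕ.suc) b n))
    (solve 5 (λ x x′ y c c′ → (x :+ x′) :* y :+ (c :+ c′) := (x :* y :+ c) :+ (x′ :* y :+ c′))
      refl (a 0) (a′ 0) (b (suc n)) (conv (a ∘ ℕ.suc) b n) (conv (a′ ∘ ℕ.suc) b n))

  conv-*ˡ : ∀ r a b n → conv (λ i → r ℚ.* a i) b n ≡ r ℚ.* conv a b n
  conv-*ˡ r a b zero    = ℚₚ.*-assoc r (a 0) (b 0)
  conv-*ˡ r a b (suc n) = trans
    (cong (r ℚ.* a 0 ℚ.* b (suc n) ℚ.+_) (conv-*ˡ r (a ∘ ℕ.suc) b n))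
    (solve 4 (λ r x y c → r :* x :* y :+ r :* c := r :* (x :* y :+ c))
      refl r (a 0) (b (suc n)) (conv (a ∘ ℕ.suc) b n))

  conv-*ʳ : ∀ r a b n → conv a (λ i → r ℚ.* b i) n ≡ r ℚ.* conv a b n
  conv-*ʳ r a b zero    = solve 3 (λ r x y → x :* (r :* y) := r :* (x :* y)) refl r (a 0) (b 0)
  conv-*ʳ r a b (suc n) = trans
    (cong (a 0 ℚ.* (r ℚ.* b (suc n)) ℚ.+_) (conv-*ʳ r (a ∘ ℕ.suc) b n))
    (solve 4 (λ r x y c → x :* (r :* y) :+ r :* c := r :* (x :* y :+ c))
      refl r (a 0) (b (suc n)) (conv (a ∘ ℕ.suc) b n))

  conv-leibniz : ∀ a b n → ∂ (conv a b) n ≡ conv (∂ a) b n ℚ.+ conv a (∂ b) n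
  conv-leibniz a b zero =
    solve 4 (λ x y x′ y′ → con 1ℚ :* (x :* y′ :+ x′ :* y) := con 1ℚ :* x′ :* y :+ x :* (con 1ℚ :* y′))
      refl (a 0) (b 0) (a 1) (b 1)
  conv-leibniz a b (suc n) = begin-equality
    ι (2 ℕ.+ n) ℚ.* (x ℚ.* y ℚ.+ (x′ ℚ.* y′ ℚ.+ c″))
      ≡⟨ cong (ℚ._* (x ℚ.* y ℚ.+ (x′ ℚ.* y′ ℚ.+ c″))) (ι-suc (suc n)) ⟩
    (1ℚ ℚ.+ j) ℚ.* (x ℚ.* y ℚ.+ (x′ ℚ.* y′ ℚ.+ c″))
      ≡⟨ solve 6 (λ j x y x′ y′ c → (con 1ℚ :+ j) :* (x :* y :+ (x′ :* y′ :+ c))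
           := x :* ((con 1ℚ :+ j) :* y) :+ (x′ :* y′ :+ c) :+ j :* (x′ :* y′ :+ c))
           refl j x y x′ y′ c″ ⟩
    x ℚ.* ((1ℚ ℚ.+ j) ℚ.* y) ℚ.+ (x′ ℚ.* y′ ℚ.+ c″) ℚ.+ j ℚ.* conv (a ∘ ℕ.suc) b (suc n)
      ≡⟨ cong₂ (λ u v → x ℚ.* (u ℚ.* y) ℚ.+ (x′ ℚ.* y′ ℚ.+ c″) ℚ.+ v)
           (sym (ι-suc (suc n))) (conv-leibniz (a ∘ ℕ.suc) b n) ⟩
    x ℚ.* ∂b ℚ.+ (x′ ℚ.* y′ ℚ.+ c″) ℚ.+ (d ℚ.+ e)
      ≡⟨ solve 6 (λ u x′ y′ c d e → u :+ (x′ :* y′ :+ c) :+ (d :+ e)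
           := (con 1ℚ :* x′ :* y′ :+ (d :+ c)) :+ (u :+ e))
           refl (x ℚ.* ∂b) x′ y′ c″ d e ⟩
    (∂ a 0 ℚ.* y′ ℚ.+ (d ℚ.+ c″)) ℚ.+ (x ℚ.* ∂b ℚ.+ e)
      ≡⟨ cong (λ z → (∂ a 0 ℚ.* y′ ℚ.+ z) ℚ.+ (x ℚ.* ∂b ℚ.+ e))
           (trans (sym (conv-+ˡ (∂ (a ∘ ℕ.suc)) (a ∘ ℕ.suc ∘ ℕ.suc) b n))
             (conv-cong (λ i → sym (∂-suc i)) (λ _ → refl) n)) ⟩
    conv (∂ a) b (suc n) ℚ.+ conv a (∂ b) (suc n) ∎
    where
    j = ι (suc n)
    x = a 0
    x′ = a 1
    y = b (2 ℕ.+ n)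
    y′ = b (suc n)
    ∂b = ∂ b (suc n)
    c″ = conv (a ∘ ℕ.suc ∘ ℕ.suc) b n
    d = conv (∂ (a ∘ ℕ.suc)) b n
    e = conv (a ∘ ℕ.suc) (∂ b) n
    -- Shifting and `∂` do not commute. The correction absorbs `c″` from the spare copy of
    -- `x′ y′ + c″` left by splitting `ι (2 + n)` as `1 + j`; its other summand is the head of
    -- `conv (∂ a) b`.
    ∂-suc : ∀ i → ∂ a (suc i) ≡ ∂ (a ∘ ℕ.suc) i ℚ.+ a (2 ℕ.+ i)
    ∂-suc i = trans (cong (ℚ._* a (2 ℕ.+ i)) (ι-suc (suc i)))
      (solve 2 (λ j z → (con 1ℚ :+ j) :* z := j :* z :+ z) refl (ι (suc i)) (a (2 ℕ.+ i)))

  ∂-expTerm : ∀ p i → ∂ (expTerm p) i ≡ p ℚ.* expTerm p i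
  ∂-expTerm p i = begin-equality
    ι (suc i) ℚ.* (expTerm p i ℚ.* p ℚ.* inv i)
      ≡⟨ solve 4 (λ j t p v → j :* (t :* p :* v) := (p :* t) :* (j :* v))
           refl (ι (suc i)) (expTerm p i) p (inv i) ⟩
    (p ℚ.* expTerm p i) ℚ.* (ι (suc i) ℚ.* inv i)
      ≡⟨ cong ((p ℚ.* expTerm p i) ℚ.*_) (ι*inv i) ⟩
    (p ℚ.* expTerm p i) ℚ.* 1ℚ
      ≡⟨ ℚₚ.*-identityʳ (p ℚ.* expTerm p i) ⟩
    p ℚ.* expTerm p i ∎

  -- Both sides have the same value at 0 and satisfy ∂ u = (p + q) u.
  conv-expTerm : ∀ p q n → conv (expTerm p) (expTerm q) n ≡ expTerm (p ℚ.+ q) n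
  conv-expTerm p q zero    = refl
  conv-expTerm p q (suc n) = begin-equality
    c (suc n)
      ≡⟨ ℚₚ.*-identityʳ (c (suc n)) ⟨
    c (suc n) ℚ.* 1ℚ
      ≡⟨ cong (c (suc n) ℚ.*_) (ι*inv n) ⟨
    c (suc n) ℚ.* (ι (suc n) ℚ.* inv n)
      ≡⟨ solve 3 (λ c j v → c :* (j :* v) := (j :* c) :* v) refl (c (suc n)) (ι (suc n)) (inv n) ⟩
    ∂ c n ℚ.* inv n
      ≡⟨ cong (ℚ._* inv n) (conv-leibniz P Q n) ⟩
    (conv (∂ P) Q n ℚ.+ conv P (∂ Q) n) ℚ.* inv n
      ≡⟨ cong₂ (λ u v → (u ℚ.+ v) ℚ.* inv n)
           (trans (conv-cong (∂-expTerm p) (λ _ → refl) n) (conv-*ˡ p P Q n))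
           (trans (conv-cong (λ _ → refl) (∂-expTerm q) n) (conv-*ʳ q P Q n)) ⟩
    (p ℚ.* c n ℚ.+ q ℚ.* c n) ℚ.* inv n
      ≡⟨ solve 4 (λ p q c v → (p :* c :+ q :* c) :* v := c :* (p :+ q) :* v) refl p q (c n) (inv n) ⟩
    c n ℚ.* (p ℚ.+ q) ℚ.* inv n
      ≡⟨ cong (λ z → z ℚ.* (p ℚ.+ q) ℚ.* inv n) (conv-expTerm p q n) ⟩
    expTerm (p ℚ.+ q) (suc n) ∎
    where
    P = expTerm p
    Q = expTerm q
    c = conv P Q

  -- Products of partial sums compared with triangular sums.

  psum : (ℕ → ℚ) → ℕ → ℚ
  psum a zero    = a 0
  psum a (suc n) = psum a n ℚ.+ a (suc n)

  psum-head : ∀ a n → psum a (suc n) ≡ a 0 ℚ.+ psum (a ∘ ℕ.suc) n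
  psum-head a zero    = refl
  psum-head a (suc n) = trans (cong (ℚ._+ a (2 ℕ.+ n)) (psum-head a n))
    (ℚₚ.+-assoc (a 0) (psum (a ∘ ℕ.suc) n) (a (2 ℕ.+ n)))

  psum-expTerm : ∀ p n → psum (expTerm p) n ≡ expSum p n
  psum-expTerm p zero    = refl
  psum-expTerm p (suc n) = cong (ℚ._+ expTerm p (suc n)) (psum-expTerm p n)

  0≤expSum : ∀ {p} → 0ℚ ℚ.≤ p → ∀ n → 0ℚ ℚ.≤ expSum p n
  0≤expSum 0≤p zero    = ℚₚ.nonNegative⁻¹ 1ℚ
  0≤expSum 0≤p (suc n) = ℚₚ.≤-trans (0≤expSum 0≤p n) (≤+ (0≤term 0≤p (suc n)))

  expSum-monoʳ : ∀ {p} → 0ℚ ℚ.≤ p → ∀ n k → expSum p n ℚ.≤ expSum p (k ℕ.+ n)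
  expSum-monoʳ 0≤p n zero    = ℚₚ.≤-refl
  expSum-monoʳ 0≤p n (suc k) =
    ℚₚ.≤-trans (expSum-monoʳ 0≤p n k) (≤+ (0≤term 0≤p (suc (k ℕ.+ n))))

  -- triangle a q n is the sum of a i * qʲ / j! over i + j ≤ n.
  triangle : (ℕ → ℚ) → ℚ → ℕ → ℚ
  triangle a q zero    = a 0 ℚ.* expSum q 0
  triangle a q (suc n) = a 0 ℚ.* expSum q (suc n) ℚ.+ triangle (a ∘ ℕ.suc) q n

  triangle-suc : ∀ a q n → triangle a q (suc n) ≡ triangle a q n ℚ.+ conv a (expTerm q) (suc n)
  triangle-suc a q zero =
    solve 4 (λ x x′ s t → x :* (s :+ t) :+ x′ :* s := x :* s :+ (x :* t :+ x′ :* s))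
      refl (a 0) (a 1) (expSum q 0) (expTerm q 1)
  triangle-suc a q (suc n) = begin-equality
    x ℚ.* (s ℚ.+ t) ℚ.+ triangle (a ∘ ℕ.suc) q (suc n)
      ≡⟨ cong (x ℚ.* (s ℚ.+ t) ℚ.+_) (triangle-suc (a ∘ ℕ.suc) q n) ⟩
    x ℚ.* (s ℚ.+ t) ℚ.+ (u ℚ.+ v)
      ≡⟨ solve 5 (λ x s t u v → x :* (s :+ t) :+ (u :+ v) := (x :* s :+ u) :+ (x :* t :+ v))
           refl x s t u v ⟩
    (x ℚ.* s ℚ.+ u) ℚ.+ (x ℚ.* t ℚ.+ v) ∎
    where
    x = a 0
    s = expSum q (suc n)
    t = expTerm q (2 ℕ.+ n)
    u = triangle (a ∘ ℕ.suc) q n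
    v = conv (a ∘ ℕ.suc) (expTerm q) (suc n)

  triangle-expTerm : ∀ p q n → triangle (expTerm p) q n ≡ expSum (p ℚ.+ q) n
  triangle-expTerm p q zero    = refl
  triangle-expTerm p q (suc n) = trans (triangle-suc (expTerm p) q n)
    (cong₂ ℚ._+_ (triangle-expTerm p q n) (conv-expTerm p q (suc n)))

  -- The index rectangle `i ≤ m`, `j ≤ n` lies inside the triangle `i + j ≤ m + n`, and no term is
  -- negative.
  psum*expSum≤triangle : ∀ {q} → 0ℚ ℚ.≤ q → ∀ a → (∀ i → 0ℚ ℚ.≤ a i) → ∀ m n →
    psum a m ℚ.* expSum q n ℚ.≤ triangle a q (m ℕ.+ n)
  psum*expSum≤triangle {q} 0≤q a 0≤a zero zero    = ℚₚ.≤-refl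
  psum*expSum≤triangle {q} 0≤q a 0≤a zero (suc n) = ≤+ (0≤triangle (a ∘ ℕ.suc) (0≤a ∘ ℕ.suc) n)
    where
    0≤triangle : ∀ a → (∀ i → 0ℚ ℚ.≤ a i) → ∀ n → 0ℚ ℚ.≤ triangle a q n
    0≤triangle a 0≤a zero    = 0≤* (0≤a 0) (0≤expSum 0≤q 0)
    0≤triangle a 0≤a (suc n) = ℚₚ.+-mono-≤ (0≤* (0≤a 0) (0≤expSum 0≤q (suc n)))
      (0≤triangle (a ∘ ℕ.suc) (0≤a ∘ ℕ.suc) n)
  psum*expSum≤triangle {q} 0≤q a 0≤a (suc m) n = begin
    psum a (suc m) ℚ.* expSum q n
      ≡⟨ cong (ℚ._* expSum q n) (psum-head a m) ⟩
    (a 0 ℚ.+ psum (a ∘ ℕ.suc) m) ℚ.* expSum q n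
      ≡⟨ ℚₚ.*-distribʳ-+ (expSum q n) (a 0) (psum (a ∘ ℕ.suc) m) ⟩
    a 0 ℚ.* expSum q n ℚ.+ psum (a ∘ ℕ.suc) m ℚ.* expSum q n
      ≤⟨ ℚₚ.+-mono-≤ (*-monoˡ (0≤a 0) (expSum-monoʳ 0≤q n (suc m)))
           (psum*expSum≤triangle 0≤q (a ∘ ℕ.suc) (0≤a ∘ ℕ.suc) m n) ⟩
    triangle a q (suc m ℕ.+ n) ∎

  ∣x*tail∣≤ : ∀ {q B} → ℚ.∣ q ∣ ℚ.≤ B → ∀ x X → ℚ.∣ x ∣ ℚ.≤ X → ∀ n j →
    ℚ.∣ x ℚ.* (expSum q (j ℕ.+ n) ℚ.- expSum q n) ∣
      ℚ.≤ X ℚ.* (expSum B (j ℕ.+ n) ℚ.- expSum B n)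
  ∣x*tail∣≤ {q} {B} q≤B x X x≤X n j = begin
    ℚ.∣ x ℚ.* (expSum q (j ℕ.+ n) ℚ.- expSum q n) ∣
      ≡⟨ ℚₚ.∣p*q∣≡∣p∣*∣q∣ x _ ⟩
    ℚ.∣ x ∣ ℚ.* ℚ.∣ expSum q (j ℕ.+ n) ℚ.- expSum q n ∣
      ≤⟨ *-mono (ℚₚ.0≤∣p∣ (expSum q (j ℕ.+ n) ℚ.- expSum q n))
           (ℚₚ.≤-trans (ℚₚ.0≤∣p∣ x) x≤X) x≤X (sum-tail {q} q≤B n j) ⟩
    X ℚ.* (expSum B (j ℕ.+ n) ℚ.- expSum B n) ∎

  -- The product of the partial sums exceeds the triangle by the terms with i ≤ n, j ≤ k
  -- and i + j > n, and these are dominated termwise.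
  ∣psum*expSum-triangle∣≤ : ∀ {q B} → ℚ.∣ q ∣ ℚ.≤ B → ∀ a A → (∀ i → ℚ.∣ a i ∣ ℚ.≤ A i) →
    ∀ n j → let k = j ℕ.+ n in
    ℚ.∣ psum a n ℚ.* expSum q k ℚ.- triangle a q n ∣
      ℚ.≤ psum A n ℚ.* expSum B k ℚ.- triangle A B n
  ∣psum*expSum-triangle∣≤ {q} {B} q≤B a A a≤A zero j = begin
    ℚ.∣ a 0 ℚ.* expSum q (j ℕ.+ 0) ℚ.- a 0 ℚ.* expSum q 0 ∣
      ≡⟨ cong ℚ.∣_∣ (factor (a 0) (expSum q (j ℕ.+ 0)) (expSum q 0)) ⟩
    ℚ.∣ a 0 ℚ.* (expSum q (j ℕ.+ 0) ℚ.- expSum q 0) ∣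
      ≤⟨ ∣x*tail∣≤ q≤B (a 0) (A 0) (a≤A 0) 0 j ⟩
    A 0 ℚ.* (expSum B (j ℕ.+ 0) ℚ.- expSum B 0)
      ≡⟨ factor (A 0) (expSum B (j ℕ.+ 0)) (expSum B 0) ⟨
    A 0 ℚ.* expSum B (j ℕ.+ 0) ℚ.- A 0 ℚ.* expSum B 0 ∎
    where
    factor : ∀ x s t → x ℚ.* s ℚ.- x ℚ.* t ≡ x ℚ.* (s ℚ.- t)
    factor = solve 3 (λ x s t → x :* s :- x :* t := x :* (s :- t)) refl
  ∣psum*expSum-triangle∣≤ {q} {B} q≤B a A a≤A (suc n) j = begin
    ℚ.∣ psum a (suc n) ℚ.* s ℚ.- (a 0 ℚ.* t ℚ.+ u) ∣
      ≡⟨ cong ℚ.∣_∣ (split a s t u) ⟩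
    ℚ.∣ a 0 ℚ.* (s ℚ.- t) ℚ.+ (psum (a ∘ ℕ.suc) n ℚ.* s ℚ.- u) ∣
      ≤⟨ ℚₚ.∣p+q∣≤∣p∣+∣q∣ (a 0 ℚ.* (s ℚ.- t)) (psum (a ∘ ℕ.suc) n ℚ.* s ℚ.- u) ⟩
    ℚ.∣ a 0 ℚ.* (s ℚ.- t) ∣ ℚ.+ ℚ.∣ psum (a ∘ ℕ.suc) n ℚ.* s ℚ.- u ∣
      ≤⟨ ℚₚ.+-mono-≤ (∣x*tail∣≤ q≤B (a 0) (A 0) (a≤A 0) (suc n) j) rest ⟩
    A 0 ℚ.* (S ℚ.- T) ℚ.+ (psum (A ∘ ℕ.suc) n ℚ.* S ℚ.- U)
      ≡⟨ split A S T U ⟨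
    psum A (suc n) ℚ.* S ℚ.- (A 0 ℚ.* T ℚ.+ U) ∎
    where
    s = expSum q (j ℕ.+ suc n)
    t = expSum q (suc n)
    u = triangle (a ∘ ℕ.suc) q n
    S = expSum B (j ℕ.+ suc n)
    T = expSum B (suc n)
    U = triangle (A ∘ ℕ.suc) B n
    -- The shift lowers `n` but leaves the second factor cut at the same degree, so the surplus `j`
    -- grows by one. This forces the general `j`, although the lemma is applied at `j = 0`.
    rest : ℚ.∣ psum (a ∘ ℕ.suc) n ℚ.* s ℚ.- u ∣ ℚ.≤ psum (A ∘ ℕ.suc) n ℚ.* S ℚ.- U
    rest = subst (λ k → ℚ.∣ psum (a ∘ ℕ.suc) n ℚ.* expSum q k ℚ.- u ∣
                          ℚ.≤ psum (A ∘ ℕ.suc) n ℚ.* expSum B k ℚ.- U)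
      (sym (ℕₚ.+-suc j n)) (∣psum*expSum-triangle∣≤ q≤B (a ∘ ℕ.suc) (A ∘ ℕ.suc) (a≤A ∘ ℕ.suc) n (suc j))
    split : ∀ a s t u → psum a (suc n) ℚ.* s ℚ.- (a 0 ℚ.* t ℚ.+ u)
      ≡ a 0 ℚ.* (s ℚ.- t) ℚ.+ (psum (a ∘ ℕ.suc) n ℚ.* s ℚ.- u)
    split a s t u = trans
      (cong (λ z → z ℚ.* s ℚ.- (a 0 ℚ.* t ℚ.+ u)) (psum-head a n))
      (solve 5 (λ x p s t u → (x :+ p) :* s :- (x :* t :+ u) := x :* (s :- t) :+ (p :* s :- u))
        refl (a 0) (psum (a ∘ ℕ.suc) n) s t u)

  -- The error is largest for `p = q = ι b`, where the square sits between the triangles of sizes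
  -- `n` and `n + n`. What remains is a stretch of the series for `2b`, whose terms at least halve
  -- from index `4b` on.
  ∣expSum*expSum-expSum∣≤ : ∀ b {p q} → ℚ.∣ p ∣ ℚ.≤ ι b → ℚ.∣ q ∣ ℚ.≤ ι b → ∀ n →
    (b ℕ.+ b) ℕ.+ (b ℕ.+ b) ℕ.≤ n →
    ℚ.∣ expSum p n ℚ.* expSum q n ℚ.- expSum (p ℚ.+ q) n ∣ ℚ.≤ expTerm (ι (b ℕ.+ b)) n
  ∣expSum*expSum-expSum∣≤ b {p} {q} p≤B q≤B n 4b≤n = begin
    ℚ.∣ expSum p n ℚ.* expSum q n ℚ.- expSum (p ℚ.+ q) n ∣
      ≡⟨ cong₂ (λ u v → ℚ.∣ u ℚ.* expSum q n ℚ.- v ∣)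
           (sym (psum-expTerm p n)) (sym (triangle-expTerm p q n)) ⟩
    ℚ.∣ psum (expTerm p) n ℚ.* expSum q n ℚ.- triangle (expTerm p) q n ∣
      ≤⟨ ∣psum*expSum-triangle∣≤ q≤B (expTerm p) (expTerm B) (∣term∣≤ p≤B) n 0 ⟩
    psum (expTerm B) n ℚ.* expSum B n ℚ.- triangle (expTerm B) B n
      ≤⟨ ℚₚ.+-monoˡ-≤ (ℚ.- triangle (expTerm B) B n)
           (psum*expSum≤triangle (0≤ι b) (expTerm B) (0≤term (0≤ι b)) n n) ⟩
    triangle (expTerm B) B (n ℕ.+ n) ℚ.- triangle (expTerm B) B n
      ≡⟨ cong₂ ℚ._-_ (diag (n ℕ.+ n)) (diag n) ⟩
    expSum (ι (b ℕ.+ b)) (n ℕ.+ n) ℚ.- expSum (ι (b ℕ.+ b)) n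
      ≤⟨ tail≤ (b ℕ.+ b) n n 4b≤n ⟩
    expTerm (ι (b ℕ.+ b)) n ∎
    where
    B = ι b
    diag : ∀ n → triangle (expTerm B) B n ≡ expSum (ι (b ℕ.+ b)) n
    diag n = trans (triangle-expTerm B B n) (cong (λ z → expSum z n) (sym (ι-+ b b)))

  1≤expSum : ∀ {p} → 0ℚ ℚ.≤ p → ∀ n → 1ℚ ℚ.≤ expSum p n
  1≤expSum {p} 0≤p n = subst (λ m → 1ℚ ℚ.≤ expSum p m) (ℕₚ.+-identityʳ n) (expSum-monoʳ 0≤p 0 n)

  expSum-0 : ∀ n → expSum 0ℚ n ≡ 1ℚ
  expSum-0 zero    = refl
  expSum-0 (suc n) = trans (cong₂ ℚ._+_ (expSum-0 n) (zero-term n)) (ℚₚ.+-identityʳ 1ℚ)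
    where
    zero-term : ∀ n → expTerm 0ℚ (suc n) ≡ 0ℚ
    zero-term n = solve 2 (λ t v → t :* con 0ℚ :* v := con 0ℚ) refl (expTerm 0ℚ n) (inv n)

  -- Comparison with the geometric series, in product form so that `p ≥ 1` is covered as well.
  1-p*expSum≤1 : ∀ {p} → 0ℚ ℚ.≤ p → ∀ n → (1ℚ ℚ.- p) ℚ.* expSum p n ℚ.≤ 1ℚ
  1-p*expSum≤1 {p} 0≤p n = ℚₚ.≤-trans (≤+ (0≤* 0≤p (0≤term 0≤p n))) (strong n)
    where
    -- With powers of `p` as terms this would be the telescoping identity for a geometric sum. The
    -- extra summand closes the induction, since each term is at most `p` times its predecessor.
    strong : ∀ n → (1ℚ ℚ.- p) ℚ.* expSum p n ℚ.+ p ℚ.* expTerm p n ℚ.≤ 1ℚ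
    strong zero = ℚₚ.≤-reflexive (solve 1 (λ p → (con 1ℚ :- p) :* con 1ℚ :+ p :* con 1ℚ := con 1ℚ) refl p)
    strong (suc n) = begin
      (1ℚ ℚ.- p) ℚ.* (s ℚ.+ t′) ℚ.+ p ℚ.* t′
        ≡⟨ solve 3 (λ p s t′ → (con 1ℚ :- p) :* (s :+ t′) :+ p :* t′ := (con 1ℚ :- p) :* s :+ t′)
             refl p s t′ ⟩
      (1ℚ ℚ.- p) ℚ.* s ℚ.+ t′
        ≤⟨ ℚₚ.+-monoʳ-≤ ((1ℚ ℚ.- p) ℚ.* s) t′≤pt ⟩
      (1ℚ ℚ.- p) ℚ.* s ℚ.+ p ℚ.* t
        ≤⟨ strong n ⟩
      1ℚ ∎
      where
      s = expSum p n
      t = expTerm p n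
      t′ = expTerm p (suc n)
      inv≤1 : inv n ℚ.≤ 1ℚ
      inv≤1 = begin
        inv n                 ≡⟨ ℚₚ.*-identityˡ (inv n) ⟨
        1ℚ ℚ.* inv n          ≤⟨ *-monoʳ (0≤inv n) (ι-mono {1} {suc n} (ℕ.s≤s ℕ.z≤n)) ⟩
        ι (suc n) ℚ.* inv n   ≡⟨ ι*inv n ⟩
        1ℚ ∎
      t′≤pt : t′ ℚ.≤ p ℚ.* t
      t′≤pt = begin
        t ℚ.* p ℚ.* inv n   ≤⟨ *-monoˡ (0≤* (0≤term 0≤p n) 0≤p) inv≤1 ⟩
        t ℚ.* p ℚ.* 1ℚ      ≡⟨ solve 2 (λ t p → t :* p :* con 1ℚ := p :* t) refl t p ⟩
        p ℚ.* t ∎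

open ℚConvolution

-- Order and arithmetic of Cauchy reals.

module ℝOrder where

  open +-*-Solver using (solve; _:+_; _:-_; _:*_; _:=_; con; :-_)
  open ℚₚ.≤-Reasoning

  Eventually : (ℕ → Set) → Set
  Eventually P = ∃[ N ] (∀ n → N ℕ.≤ n → P n)

  infix 4 _≤ᵉ_ _≲_

  _≤ᵉ_ : (x y : ℕ → ℚ) → Set
  x ≤ᵉ y = Eventually λ n → x n ℚ.≤ y n

  -- A positive form of `_≤_`, which is itself only a refutation and yields no estimate on entries;
  -- `≲⇒≤` and `≤⇒≲` pass between the two.
  _≲_ : ℝ → ℝ → Set
  x ≲ y = ∀ ε → 0ℚ ℚ.< ε → seq x ≤ᵉ λ n → seq y n ℚ.+ ε

  infixr 4 _⊓ᵉ_
  _⊓ᵉ_ : ∀ {P Q : ℕ → Set} → Eventually P → Eventually Q → Eventually λ n → P n × Q n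
  (M , p) ⊓ᵉ (N , q) = M ℕ.⊔ N , λ n ≤n → p n (≤-⊔ˡ {M} {N} ≤n) , q n (≤-⊔ʳ {M} {N} ≤n)

  mapᵉ : ∀ {P Q : ℕ → Set} → (∀ n → P n → Q n) → Eventually P → Eventually Q
  mapᵉ h (N , p) = N , λ n N≤n → h n (p n N≤n)

  <⇒≱ : ∀ {p q} → p ℚ.< q → ¬ (q ℚ.≤ p)
  <⇒≱ p<q q≤p = ℚₚ.<-irrefl refl (ℚₚ.<-≤-trans p<q q≤p)

  0<½* : ∀ {ε} → 0ℚ ℚ.< ε → 0ℚ ℚ.< ½ ℚ.* ε
  0<½* 0<ε = 0<* (ℚₚ.positive⁻¹ ½) 0<ε

  halves : ∀ ε → ½ ℚ.* ε ℚ.+ ½ ℚ.* ε ≡ ε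
  halves = solve 1 (λ e → con ½ :* e :+ con ½ :* e := e) refl

  p<p+ε : ∀ p {ε} → 0ℚ ℚ.< ε → p ℚ.< p ℚ.+ ε
  p<p+ε p {ε} 0<ε = subst (ℚ._< p ℚ.+ ε) (ℚₚ.+-identityʳ p) (ℚₚ.+-monoʳ-< p 0<ε)

  ∣p-q∣≤ε⇒p≤q+ε : ∀ p q {ε} → ℚ.∣ p ℚ.- q ∣ ℚ.≤ ε → p ℚ.≤ q ℚ.+ ε
  ∣p-q∣≤ε⇒p≤q+ε p q {ε} h = begin
    p                       ≡⟨ solve 2 (λ p q → p := q :+ (p :- q)) refl p q ⟩
    q ℚ.+ (p ℚ.- q)         ≤⟨ ℚₚ.+-monoʳ-≤ q (ℚₚ.≤-trans (p≤∣p∣ (p ℚ.- q)) h) ⟩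
    q ℚ.+ ε                 ∎
    where
    p≤∣p∣ : ∀ p → p ℚ.≤ ℚ.∣ p ∣
    p≤∣p∣ p with ℚₚ.≤-total 0ℚ p
    ... | inj₁ 0≤p = ℚₚ.≤-reflexive (sym (ℚₚ.0≤p⇒∣p∣≡p 0≤p))
    ... | inj₂ p≤0 = ℚₚ.≤-trans p≤0 (ℚₚ.0≤∣p∣ p)

  ≲⇒≤ : ∀ {x y} → x ≲ y → x ≤ y
  ≲⇒≤ {x} {y} x≲y (ε , 0<ε , y+ε≤x) with y+ε≤x ⊓ᵉ x≲y (½ ℚ.* ε) (0<½* 0<ε)
  ... | N , h = <⇒≱ y+½ε<y+ε (ℚₚ.≤-trans (proj₁ (h N ℕₚ.≤-refl)) (proj₂ (h N ℕₚ.≤-refl)))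
    where
    y+½ε<y+ε : seq y N ℚ.+ ½ ℚ.* ε ℚ.< seq y N ℚ.+ ε
    y+½ε<y+ε = subst (seq y N ℚ.+ ½ ℚ.* ε ℚ.<_)
      (trans (ℚₚ.+-assoc (seq y N) (½ ℚ.* ε) (½ ℚ.* ε)) (cong (seq y N ℚ.+_) (halves ε)))
      (p<p+ε (seq y N ℚ.+ ½ ℚ.* ε) (0<½* 0<ε))

  -- If x N > y N + ε/2 at an index N beyond the ε/8 moduli, then y < x.
  ≤⇒≲ : ∀ {x y} → x ≤ y → x ≲ y
  ≤⇒≲ {x} {y} x≤y ε 0<ε with cauchy x (½ ℚ.* (½ ℚ.* (½ ℚ.* ε))) (0<½* (0<½* (0<½* 0<ε)))
                            | cauchy y (½ ℚ.* (½ ℚ.* (½ ℚ.* ε))) (0<½* (0<½* (0<½* 0<ε)))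
  ... | Nx , hx | Ny , hy = N , close (seq x N ℚₚ.≤? seq y N ℚ.+ ½ ℚ.* ε)
    where
    N = Nx ℕ.⊔ Ny
    δ = ½ ℚ.* (½ ℚ.* (½ ℚ.* ε))
    N≤x : ∀ {n} → N ℕ.≤ n → Nx ℕ.≤ n
    N≤x = ≤-⊔ˡ {Nx} {Ny}
    N≤y : ∀ {n} → N ℕ.≤ n → Ny ℕ.≤ n
    N≤y = ≤-⊔ʳ {Nx} {Ny}
    refl≤ = ℕₚ.≤-refl {N}
    close : _ → ∀ n → N ℕ.≤ n → seq x n ℚ.≤ seq y n ℚ.+ ε
    close (yes x≤) n N≤n = begin
      seq x n
        ≤⟨ ∣p-q∣≤ε⇒p≤q+ε (seq x n) (seq x N) (hx n N (N≤x N≤n) (N≤x refl≤)) ⟩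
      seq x N ℚ.+ δ
        ≤⟨ ℚₚ.+-monoˡ-≤ δ x≤ ⟩
      (seq y N ℚ.+ ½ ℚ.* ε) ℚ.+ δ
        ≤⟨ ℚₚ.+-monoˡ-≤ δ (ℚₚ.+-monoˡ-≤ (½ ℚ.* ε)
             (∣p-q∣≤ε⇒p≤q+ε (seq y N) (seq y n) (hy N n (N≤y refl≤) (N≤y N≤n)))) ⟩
      ((seq y n ℚ.+ δ) ℚ.+ ½ ℚ.* ε) ℚ.+ δ
        ≤⟨ ≤+ (ℚₚ.<⇒≤ (0<½* (0<½* 0<ε))) ⟩
      (((seq y n ℚ.+ δ) ℚ.+ ½ ℚ.* ε) ℚ.+ δ) ℚ.+ ½ ℚ.* (½ ℚ.* ε)
        ≡⟨ solve 2 (λ y e → (((y :+ con ½ :* (con ½ :* (con ½ :* e))) :+ con ½ :* e)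
             :+ con ½ :* (con ½ :* (con ½ :* e))) :+ con ½ :* (con ½ :* e) := y :+ e) refl (seq y n) ε ⟩
      seq y n ℚ.+ ε ∎
    close (no x≰) n _ = contradiction (½ ℚ.* (½ ℚ.* ε) , 0<½* (0<½* 0<ε) , N , gap) x≤y
      where
      gap : ∀ n → N ℕ.≤ n → seq y n ℚ.+ ½ ℚ.* (½ ℚ.* ε) ℚ.≤ seq x n
      gap n N≤n = begin
        seq y n ℚ.+ ½ ℚ.* (½ ℚ.* ε)
          ≤⟨ ℚₚ.+-monoˡ-≤ (½ ℚ.* (½ ℚ.* ε))
               (∣p-q∣≤ε⇒p≤q+ε (seq y n) (seq y N) (hy n N (N≤y N≤n) (N≤y refl≤))) ⟩
        (seq y N ℚ.+ δ) ℚ.+ ½ ℚ.* (½ ℚ.* ε)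
          ≡⟨ solve 2 (λ y e → (y :+ con ½ :* (con ½ :* (con ½ :* e))) :+ con ½ :* (con ½ :* e)
               := (y :+ con ½ :* e) :- con ½ :* (con ½ :* (con ½ :* e))) refl (seq y N) ε ⟩
        (seq y N ℚ.+ ½ ℚ.* ε) ℚ.- δ
          ≤⟨ ℚₚ.+-monoˡ-≤ (ℚ.- δ) (ℚₚ.<⇒≤ (ℚₚ.≰⇒> x≰)) ⟩
        seq x N ℚ.- δ
          ≤⟨ ℚₚ.+-monoˡ-≤ (ℚ.- δ)
               (∣p-q∣≤ε⇒p≤q+ε (seq x N) (seq x n) (hx N n (N≤x refl≤) (N≤x N≤n))) ⟩
        (seq x n ℚ.+ δ) ℚ.- δ
          ≡⟨ solve 2 (λ x d → (x :+ d) :- d := x) refl (seq x n) δ ⟩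
        seq x n ∎

  -- The cap `δ ≤ 1` lets the constant `C` absorb errors of second order in `δ`, as they arise in
  -- products.
  ≤-up-to : ∀ {x y} C → 0ℚ ℚ.< C →
    (∀ δ → 0ℚ ℚ.< δ → δ ℚ.≤ 1ℚ → seq x ≤ᵉ λ n → seq y n ℚ.+ C ℚ.* δ) → x ≤ y
  ≤-up-to {x} {y} C 0<C h = ≲⇒≤ {x} {y} λ ε 0<ε →
    mapᵉ (λ n x≤ → ℚₚ.≤-trans x≤ (ℚₚ.+-monoʳ-≤ (seq y n) (Cδ≤ε ε)))
      (h (δ ε) (0<δ ε 0<ε) (ℚₚ.p⊓q≤q (1/C ℚ.* ε) 1ℚ))
    where
    1/C : ℚ
    1/C = (ℚ.1/ C) {{ℚ.>-nonZero 0<C}}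
    δ : ℚ → ℚ
    δ ε = (1/C ℚ.* ε) ℚ.⊓ 1ℚ
    0<δ : ∀ ε → 0ℚ ℚ.< ε → 0ℚ ℚ.< δ ε
    0<δ ε 0<ε with ℚₚ.⊓-sel (1/C ℚ.* ε) 1ℚ
    ... | inj₁ eq = subst (0ℚ ℚ.<_) (sym eq) (0<* (0<1/ 0<C) 0<ε)
    ... | inj₂ eq = subst (0ℚ ℚ.<_) (sym eq) (ℚₚ.positive⁻¹ 1ℚ)
    Cδ≤ε : ∀ ε → C ℚ.* δ ε ℚ.≤ ε
    Cδ≤ε ε = begin
      C ℚ.* δ ε            ≤⟨ *-monoˡ (ℚₚ.<⇒≤ 0<C) (ℚₚ.p⊓q≤p (1/C ℚ.* ε) 1ℚ) ⟩
      C ℚ.* (1/C ℚ.* ε)    ≡⟨ ℚₚ.*-assoc C 1/C ε ⟨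
      (C ℚ.* 1/C) ℚ.* ε    ≡⟨ cong (ℚ._* ε) (ℚₚ.*-inverseʳ C {{ℚ.>-nonZero 0<C}}) ⟩
      1ℚ ℚ.* ε             ≡⟨ ℚₚ.*-identityˡ ε ⟩
      ε ∎

  ≤ᵉ⇒≤ : ∀ {x y} → seq x ≤ᵉ seq y → x ≤ y
  ≤ᵉ⇒≤ {x} {y} x≤y = ≲⇒≤ {x} {y} λ ε 0<ε →
    mapᵉ (λ n x≤y → ℚₚ.≤-trans x≤y (≤+ (ℚₚ.<⇒≤ 0<ε))) x≤y

  pointwise : ∀ {x y} → (∀ n → seq x n ≡ seq y n) → x ≤ y
  pointwise {x} {y} x≡y = ≤ᵉ⇒≤ {x} {y} (0 , λ n _ → ℚₚ.≤-reflexive (x≡y n))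

  ≤-refl : ∀ {x} → x ≤ x
  ≤-refl {x} = pointwise {x} {x} λ _ → refl

  ≤-trans : ∀ {x y z} → x ≤ y → y ≤ z → x ≤ z
  ≤-trans {x} {y} {z} x≤y y≤z = ≲⇒≤ {x} {z} λ ε 0<ε →
    mapᵉ (λ n (p , q) → begin
      seq x n                              ≤⟨ p ⟩
      seq y n ℚ.+ ½ ℚ.* ε                  ≤⟨ ℚₚ.+-monoˡ-≤ (½ ℚ.* ε) q ⟩
      (seq z n ℚ.+ ½ ℚ.* ε) ℚ.+ ½ ℚ.* ε
        ≡⟨ trans (ℚₚ.+-assoc (seq z n) (½ ℚ.* ε) (½ ℚ.* ε)) (cong (seq z n ℚ.+_) (halves ε)) ⟩
      seq z n ℚ.+ ε                        ∎)
    (≤⇒≲ {x} {y} x≤y (½ ℚ.* ε) (0<½* 0<ε) ⊓ᵉ ≤⇒≲ {y} {z} y≤z (½ ℚ.* ε) (0<½* 0<ε))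

  ≤-stable : ∀ {x y} → ¬ ¬ (x ≤ y) → x ≤ y
  ≤-stable ¬¬x≤y y<x = ¬¬x≤y λ x≤y → x≤y y<x

  <⇒≤ : ∀ {x y} → x < y → x ≤ y
  <⇒≤ {x} {y} (ε , 0<ε , h) = ≤ᵉ⇒≤ {x} {y}
    (mapᵉ (λ n x+ε≤y → ℚₚ.≤-trans (≤+ (ℚₚ.<⇒≤ 0<ε)) x+ε≤y) h)

  0<x⇒0≤ᵉx : ∀ {x} → 0ℝ < x → (λ _ → 0ℚ) ≤ᵉ seq x
  0<x⇒0≤ᵉx {x} (ε , 0<ε , h) = mapᵉ (λ n 0+ε≤x →
    ℚₚ.≤-trans (ℚₚ.<⇒≤ 0<ε) (subst (ℚ._≤ seq x n) (ℚₚ.+-identityˡ ε) 0+ε≤x)) h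

  -- The order of `p` and `q` is not decided: `p ≤ q` is the refutation of `q < p`, and once `y < x`
  -- is assumed, `h₂` provides that refutation for `h₁`.
  ≤-cases : ∀ p q {x y} → (p ≤ q → x ≤ y) → (q ≤ p → x ≤ y) → x ≤ y
  ≤-cases p q h₁ h₂ y<x = h₁ (λ q<p → h₂ (<⇒≤ {q} {p} q<p) y<x) y<x

  +-mono-≤ : ∀ {x y u v} → x ≤ y → u ≤ v → x + u ≤ y + v
  +-mono-≤ {x} {y} {u} {v} x≤y u≤v = ≲⇒≤ {x + u} {y + v} λ ε 0<ε →
    mapᵉ (λ n (p , q) → begin
      seq x n ℚ.+ seq u n
        ≤⟨ ℚₚ.+-mono-≤ p q ⟩
      (seq y n ℚ.+ ½ ℚ.* ε) ℚ.+ (seq v n ℚ.+ ½ ℚ.* ε)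
        ≡⟨ solve 3 (λ y v e → (y :+ con ½ :* e) :+ (v :+ con ½ :* e) := (y :+ v) :+ e)
             refl (seq y n) (seq v n) ε ⟩
      (seq y n ℚ.+ seq v n) ℚ.+ ε ∎)
    (≤⇒≲ {x} {y} x≤y (½ ℚ.* ε) (0<½* 0<ε) ⊓ᵉ ≤⇒≲ {u} {v} u≤v (½ ℚ.* ε) (0<½* 0<ε))

  +-monoˡ-≤ : ∀ z {x y} → x ≤ y → x + z ≤ y + z
  +-monoˡ-≤ z {x} {y} x≤y = +-mono-≤ {x} {y} {z} {z} x≤y (≤-refl {z})

  +-monoʳ-≤ : ∀ z {x y} → x ≤ y → z + x ≤ z + y
  +-monoʳ-≤ z {x} {y} x≤y = +-mono-≤ {z} {z} {x} {y} (≤-refl {z}) x≤y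

  x≤y⇒0≤y-x : ∀ {x y} → x ≤ y → 0ℝ ≤ y - x
  x≤y⇒0≤y-x {x} {y} x≤y = ≤-trans {0ℝ} {x - x} {y - x}
    (pointwise {0ℝ} {x - x} λ n → sym (ℚₚ.+-inverseʳ (seq x n)))
    (+-monoˡ-≤ (- x) {x} {y} x≤y)

  0≤y-x⇒x≤y : ∀ {x y} → 0ℝ ≤ y - x → x ≤ y
  0≤y-x⇒x≤y {x} {y} h = ≤-trans {x} {0ℝ + x} {y}
    (pointwise {x} {0ℝ + x} λ n → sym (ℚₚ.+-identityˡ (seq x n)))
    (≤-trans {0ℝ + x} {(y - x) + x} {y} (+-monoˡ-≤ x {0ℝ} {y - x} h)
      (pointwise {(y - x) + x} {y} λ n →
        solve 2 (λ x y → (y :- x) :+ x := y) refl (seq x n) (seq y n)))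

  -- From (x + δ)(y + δ) ≥ 0 one gets x y ≥ - δ (x + y + δ).
  0≤*ℝ : ∀ {x y} → 0ℝ ≤ x → 0ℝ ≤ y → 0ℝ ≤ x * y
  0≤*ℝ {x} {y} 0≤x 0≤y = ≤-up-to {0ℝ} {x * y} C 0<C λ δ 0<δ δ≤1 →
    mapᵉ (λ n (p , q , x≤bx , y≤by) → begin
      0ℚ
        ≤⟨ 0≤* p q ⟩
      (seq x n ℚ.+ δ) ℚ.* (seq y n ℚ.+ δ)
        ≡⟨ solve 3 (λ x y d → (x :+ d) :* (y :+ d) := x :* y :+ (x :+ y :+ d) :* d)
             refl (seq x n) (seq y n) δ ⟩
      seq x n ℚ.* seq y n ℚ.+ (seq x n ℚ.+ seq y n ℚ.+ δ) ℚ.* δ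
        ≤⟨ ℚₚ.+-monoʳ-≤ (seq x n ℚ.* seq y n) (*-monoʳ (ℚₚ.<⇒≤ 0<δ)
             (ℚₚ.+-mono-≤ (ℚₚ.+-mono-≤ (bound-above x≤bx) (bound-above y≤by)) δ≤1)) ⟩
      seq x n ℚ.* seq y n ℚ.+ C ℚ.* δ ∎)
    (≤⇒≲ {0ℝ} {x} 0≤x δ 0<δ ⊓ᵉ ≤⇒≲ {0ℝ} {y} 0≤y δ 0<δ ⊓ᵉ proj₂ bx ⊓ᵉ proj₂ by)
    where
    bx = bounded (seq x) (cauchy x)
    by = bounded (seq y) (cauchy y)
    C : ℚ
    C = ι (proj₁ bx) ℚ.+ ι (proj₁ by) ℚ.+ 1ℚ
    0<C : 0ℚ ℚ.< C
    0<C = ℚₚ.<-≤-trans (ℚₚ.positive⁻¹ 1ℚ) (subst (ℚ._≤ C) (ℚₚ.+-identityˡ 1ℚ)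
      (ℚₚ.+-monoˡ-≤ 1ℚ (ℚₚ.≤-trans (0≤ι (proj₁ bx)) (≤+ (0≤ι (proj₁ by))))))
    bound-above : ∀ {p B} → ℚ.∣ p ∣ ℚ.≤ B → p ℚ.≤ B
    bound-above {p} {B} h = subst (p ℚ.≤_) (ℚₚ.+-identityˡ B)
      (∣p-q∣≤ε⇒p≤q+ε p 0ℚ (subst (λ z → ℚ.∣ z ∣ ℚ.≤ B) (sym (ℚₚ.+-identityʳ p)) h))

  *-monoˡ-≤ : ∀ z {x y} → 0ℝ ≤ z → x ≤ y → z * x ≤ z * y
  *-monoˡ-≤ z {x} {y} 0≤z x≤y = 0≤y-x⇒x≤y {z * x} {z * y}
    (≤-trans {0ℝ} {z * (y - x)} {z * y - z * x}
      (0≤*ℝ {z} {y - x} 0≤z (x≤y⇒0≤y-x {x} {y} x≤y))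
      (pointwise {z * (y - x)} {z * y - z * x} λ n →
        solve 3 (λ x y z → z :* (y :- x) := z :* y :- z :* x) refl (seq x n) (seq y n) (seq z n)))

  *-monoʳ-≤ : ∀ z {x y} → 0ℝ ≤ z → x ≤ y → x * z ≤ y * z
  *-monoʳ-≤ z {x} {y} 0≤z x≤y = 0≤y-x⇒x≤y {x * z} {y * z}
    (≤-trans {0ℝ} {z * (y - x)} {y * z - x * z}
      (0≤*ℝ {z} {y - x} 0≤z (x≤y⇒0≤y-x {x} {y} x≤y))
      (pointwise {z * (y - x)} {y * z - x * z} λ n →
        solve 3 (λ x y z → z :* (y :- x) := y :* z :- x :* z) refl (seq x n) (seq y n) (seq z n)))

  -- A gap `ε` between the factors and an eventual lower bound `η` on `z` give a gap `ε * η` between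
  -- the products.
  *-cancelʳ-≤ : ∀ z {x y} → 0ℝ < z → x * z ≤ y * z → x ≤ y
  *-cancelʳ-≤ z {x} {y} (η , 0<η , η≤z) xz≤yz (ε , 0<ε , y+ε≤x) =
    xz≤yz (ε ℚ.* η , 0<* 0<ε 0<η , mapᵉ (λ n (0+η≤z , y+ε≤x) →
      let η≤z = subst (ℚ._≤ seq z n) (ℚₚ.+-identityˡ η) 0+η≤z in begin
      seq y n ℚ.* seq z n ℚ.+ ε ℚ.* η
        ≤⟨ ℚₚ.+-monoʳ-≤ (seq y n ℚ.* seq z n) (*-monoˡ (ℚₚ.<⇒≤ 0<ε) η≤z) ⟩
      seq y n ℚ.* seq z n ℚ.+ ε ℚ.* seq z n
        ≡⟨ ℚₚ.*-distribʳ-+ (seq z n) (seq y n) ε ⟨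
      (seq y n ℚ.+ ε) ℚ.* seq z n
        ≤⟨ *-monoʳ (ℚₚ.≤-trans (ℚₚ.<⇒≤ 0<η) η≤z) y+ε≤x ⟩
      seq x n ℚ.* seq z n ∎) (η≤z ⊓ᵉ y+ε≤x))

  -- Reciprocals and the exponential function on the reals.

  0≤seq-recip : ∀ {x} (0<x : 0ℝ < x) n → 0ℚ ℚ.≤ seq (recip x 0<x) n
  0≤seq-recip {x} (ε , 0<ε , N , ε≤x) n =
    ℚₚ.<⇒≤ (0<1/ (ℚₚ.<-≤-trans 0<ε (tail≥ {x} {ε} {N} ε≤x n)))

  0≤recip : ∀ {x} (0<x : 0ℝ < x) → 0ℝ ≤ recip x 0<x
  0≤recip {x} 0<x = ≤ᵉ⇒≤ {0ℝ} {recip x 0<x} (0 , λ n _ → 0≤seq-recip {x} 0<x n)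

  -- Not an index-wise fact, because `recip` reads `x` at `N + n`. An excess `η` would put `x n` at
  -- least `ε * η` above `a`, which the Cauchy modulus for half that distance excludes.
  recip*x≤1 : ∀ {x} (0<x : 0ℝ < x) → recip x 0<x * x ≤ 1ℝ
  recip*x≤1 {x} 0<x@(ε , 0<ε , N , ε≤x) (η , 0<η , M , h)
    with cauchy x (½ ℚ.* (ε ℚ.* η)) (0<½* (0<* 0<ε 0<η))
  ... | K , c = <⇒≱ (p<p+ε (a ℚ.+ ½ ℚ.* (ε ℚ.* η)) (0<½* (0<* 0<ε 0<η))) (begin
      (a ℚ.+ ½ ℚ.* (ε ℚ.* η)) ℚ.+ ½ ℚ.* (ε ℚ.* η)
        ≡⟨ trans (ℚₚ.+-assoc a _ _) (cong (a ℚ.+_) (halves (ε ℚ.* η))) ⟩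
      a ℚ.+ ε ℚ.* η
        ≤⟨ ℚₚ.+-monoʳ-≤ a (*-monoʳ (ℚₚ.<⇒≤ 0<η) (tail≥ {x} {ε} {N} ε≤x n)) ⟩
      a ℚ.+ a ℚ.* η
        ≡⟨ solve 2 (λ a e → a :+ a :* e := a :* (con 1ℚ :+ e)) refl a η ⟩
      a ℚ.* (1ℚ ℚ.+ η)
        ≤⟨ *-monoˡ (ℚₚ.<⇒≤ 0<a) (h n (ℕₚ.m≤m⊔n M K)) ⟩
      a ℚ.* (b ℚ.* seq x n)
        ≡⟨ ℚₚ.*-assoc a b (seq x n) ⟨
      (a ℚ.* b) ℚ.* seq x n
        ≡⟨ cong (ℚ._* seq x n) (ℚₚ.*-inverseʳ a {{ℚ.>-nonZero 0<a}}) ⟩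
      1ℚ ℚ.* seq x n
        ≡⟨ ℚₚ.*-identityˡ (seq x n) ⟩
      seq x n
        ≤⟨ ∣p-q∣≤ε⇒p≤q+ε (seq x n) a (c n (N ℕ.+ n) (ℕₚ.m≤n⊔m M K)
             (ℕₚ.≤-trans (ℕₚ.m≤n⊔m M K) (ℕₚ.m≤n+m n N))) ⟩
      a ℚ.+ ½ ℚ.* (ε ℚ.* η) ∎)
    where
    n = M ℕ.⊔ K
    a = seq x (N ℕ.+ n)
    b = seq (recip x 0<x) n
    0<a : 0ℚ ℚ.< a
    0<a = ℚₚ.<-≤-trans 0<ε (tail≥ {x} ε≤x n)

  -- Truncation leaves an error at each index, but it is at most a single term of the series for
  -- `2b`, and those terms tend to 0.
  exp≤exp*exp : ∀ x y → exp (x + y) ≤ exp x * exp y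
  exp≤exp*exp x y = ≲⇒≤ {exp (x + y)} {exp x * exp y} λ ε 0<ε →
    mapᵉ (λ n (x≤bx , y≤by , 4b≤n , T≤ε) →
      ∣p-q∣≤ε⇒p≤q+ε (seq (exp (x + y)) n) (seq (exp x * exp y) n) (ℚₚ.≤-trans
        (ℚₚ.≤-reflexive (∣-∣-swap (seq (exp (x + y)) n) (seq (exp x * exp y) n)))
        (ℚₚ.≤-trans
          (∣expSum*expSum-expSum∣≤ b {seq x n} {seq y n}
            (ℚₚ.≤-trans x≤bx (ι-mono (ℕₚ.m≤m+n (proj₁ bx) (proj₁ by))))
            (ℚₚ.≤-trans y≤by (ι-mono (ℕₚ.m≤n+m (proj₁ by) (proj₁ bx)))) n 4b≤n)
          T≤ε)))
    (proj₂ bx ⊓ᵉ proj₂ by ⊓ᵉ (_ , λ _ 4b≤n → 4b≤n) ⊓ᵉ term→0 (b ℕ.+ b) ε 0<ε)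
    where
    bx = bounded (seq x) (cauchy x)
    by = bounded (seq y) (cauchy y)
    b = proj₁ bx ℕ.+ proj₁ by

  1≤exp[-x]*exp[x] : ∀ x → 1ℝ ≤ exp (- x) * exp x
  1≤exp[-x]*exp[x] x = ≤-trans {1ℝ} {exp (- x + x)} {exp (- x) * exp x}
    (pointwise {1ℝ} {exp (- x + x)} λ n →
      sym (trans (cong (λ z → expSum z n) (ℚₚ.+-inverseˡ (seq x n))) (expSum-0 n)))
    (exp≤exp*exp (- x) x)

  0<exp : ∀ {x} → (λ _ → 0ℚ) ≤ᵉ seq x → 0ℝ < exp x
  0<exp {x} 0≤x = 1ℚ , ℚₚ.positive⁻¹ 1ℚ , mapᵉ (λ n 0≤x →
    subst (ℚ._≤ expSum (seq x n) n) (sym (ℚₚ.+-identityˡ 1ℚ)) (1≤expSum 0≤x n)) 0≤x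

  -- Partial sums at negative arguments can be negative, so the sign is read off from the product
  -- with the positive `exp x`.
  0≤exp[-x] : ∀ {x} → (λ _ → 0ℚ) ≤ᵉ seq x → 0ℝ ≤ exp (- x)
  0≤exp[-x] {x} 0≤x = *-cancelʳ-≤ (exp x) {0ℝ} {exp (- x)} (0<exp {x} 0≤x)
    (≤-trans {0ℝ * exp x} {1ℝ} {exp (- x) * exp x}
      (≤ᵉ⇒≤ {0ℝ * exp x} {1ℝ} (0 , λ n _ → subst (ℚ._≤ 1ℚ)
        (sym (ℚₚ.*-zeroˡ (expSum (seq x n) n))) (ℚₚ.nonNegative⁻¹ 1ℚ)))
      (1≤exp[-x]*exp[x] x))

  [1-x]*exp[x]≤1 : ∀ {x} → (λ _ → 0ℚ) ≤ᵉ seq x → (1ℝ - x) * exp x ≤ 1ℝ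
  [1-x]*exp[x]≤1 {x} 0≤x = ≤ᵉ⇒≤ {(1ℝ - x) * exp x} {1ℝ}
    (mapᵉ (λ n 0≤x → 1-p*expSum≤1 0≤x n) 0≤x)

  sum-map≤length* : ∀ {A : Set} (g : A → ℝ) δ {xs} → All (λ x → g x ≤ δ) xs →
    sum (map g xs) ≤ fromℕ (length xs) * δ
  sum-map≤length* g δ [] = pointwise {0ℝ} {fromℕ 0 * δ} λ n → sym (ℚₚ.*-zeroˡ (seq δ n))
  sum-map≤length* g δ {x ∷ xs} (gx≤δ ∷ gxs≤δ) =
    ≤-trans {g x + sum (map g xs)} {δ + fromℕ (length xs) * δ} {fromℕ (suc (length xs)) * δ}
      (+-mono-≤ {g x} {δ} {sum (map g xs)} {fromℕ (length xs) * δ} gx≤δ (sum-map≤length* g δ gxs≤δ))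
      (pointwise {δ + fromℕ (length xs) * δ} {fromℕ (suc (length xs)) * δ} λ n →
        trans (solve 2 (λ d l → d :+ l :* d := (con 1ℚ :+ l) :* d) refl (seq δ n) (ι (length xs)))
          (cong (ℚ._* seq δ n) (sym (ι-suc (length xs)))))

-- Chains of inequalities between reals.

module ≤-Reasoning where

  infix  1 begin_
  infixr 2 step-≤ step-≈
  infix  3 _∎

  -- _≤_ unfolds to a negation from which its arguments cannot be inferred.
  record _IsAtMost_ (x y : ℝ) : Set where
    constructor isAtMost
    field isAtMost⁻¹ : x ≤ y

  begin_ : ∀ {x y} → x IsAtMost y → x ≤ y
  begin isAtMost x≤y = x≤y

  step-≤ : ∀ x {y z} → y IsAtMost z → x ≤ y → x IsAtMost z
  step-≤ x {y} {z} (isAtMost y≤z) x≤y = isAtMost (ℝOrder.≤-trans {x} {y} {z} x≤y y≤z)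

  step-≈ : ∀ x {y z} → y IsAtMost z → (∀ n → seq x n ≡ seq y n) → x IsAtMost z
  step-≈ x {y} y≤z x≡y = step-≤ x y≤z (ℝOrder.pointwise {x} {y} x≡y)

  syntax step-≤ x y≤z x≤y = x ≤⟨ x≤y ⟩ y≤z
  syntax step-≈ x y≤z x≡y = x ≈⟨ x≡y ⟩ y≤z

  _∎ : ∀ x → x IsAtMost x
  x ∎ = isAtMost (ℝOrder.≤-refl {x})

open ℝOrder

-- Finite subsets and single-element exchanges.

module SubsetLemmas where

  private variable
    n : ℕ
    p q r : Subset n
    x y : Fin n

  x∈p─q⇒x∉q : x ∈ p ─ q → x ∉ q
  x∈p─q⇒x∉q {p = _ ∷ _} {q = outside ∷ _} here ()
  x∈p─q⇒x∉q {p = _ ∷ p} {q = outside ∷ q} (there x∈) (there x∈q) = x∈p─q⇒x∉q x∈ x∈q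
  x∈p─q⇒x∉q {p = _ ∷ p} {q = inside ∷ q} (there x∈) (there x∈q) = x∈p─q⇒x∉q x∈ x∈q

  x∈p─q⇒x∈p : x ∈ p ─ q → x ∈ p
  x∈p─q⇒x∈p {p = p} {q} = p─q⊆p p q

  x∉p-x : x ∉ p Subset.- x
  x∉p-x {x = x} x∈ = x∈p─q⇒x∉q x∈ (x∈⁅x⁆ x)

  ∪-lub : p ⊆ r → q ⊆ r → p ∪ q ⊆ r
  ∪-lub {p = p} {q = q} p⊆r q⊆r x∈ with x∈p∪q⁻ p q x∈
  ... | inj₁ x∈p = p⊆r x∈p
  ... | inj₂ x∈q = q⊆r x∈q

  ⁅⁆⊆ : x ∈ p → ⁅ x ⁆ ⊆ p
  ⁅⁆⊆ {x = x} {p = p} x∈p z∈ = subst (_∈ p) (sym (x∈⁅y⁆⇒x≡y x z∈)) x∈p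

  ∈∪ˡ : x ∈ p → x ∈ p ∪ q
  ∈∪ˡ x∈p = x∈p∪q⁺ (inj₁ x∈p)

  ∈∪ʳ : x ∈ q → x ∈ p ∪ q
  ∈∪ʳ x∈q = x∈p∪q⁺ (inj₂ x∈q)

  x∈p∪⁅x⁆ : x ∈ p ∪ ⁅ x ⁆
  x∈p∪⁅x⁆ {x = x} = ∈∪ʳ (x∈⁅x⁆ x)

  x∈p∪⁅y⁆⁻ : x ∈ p ∪ ⁅ y ⁆ → x ∈ p ⊎ x ≡ y
  x∈p∪⁅y⁆⁻ {p = p} {y} x∈ with x∈p∪q⁻ p ⁅ y ⁆ x∈
  ... | inj₁ x∈p = inj₁ x∈p
  ... | inj₂ x∈y = inj₂ (x∈⁅y⁆⇒x≡y y x∈y)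

  ∣p∪⁅x⁆∣≡ : x ∉ p → Subset.∣ p ∪ ⁅ x ⁆ ∣ ≡ suc Subset.∣ p ∣
  ∣p∪⁅x⁆∣≡ {x = zero}  {p = inside ∷ p}  x∉p = contradiction here x∉p
  ∣p∪⁅x⁆∣≡ {x = zero}  {p = outside ∷ p} x∉p = cong (suc ∘ Subset.∣_∣) (∪-identityʳ p)
  ∣p∪⁅x⁆∣≡ {x = suc x} {p = inside ∷ p}  x∉p = cong suc (∣p∪⁅x⁆∣≡ (x∉p ∘ there))
  ∣p∪⁅x⁆∣≡ {x = suc x} {p = outside ∷ p} x∉p = ∣p∪⁅x⁆∣≡ (x∉p ∘ there)

  suc∣p-x∣≡ : x ∈ p → suc Subset.∣ p Subset.- x ∣ ≡ Subset.∣ p ∣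
  suc∣p-x∣≡ {x = x} {p} x∈p = trans (sym (∣p∪⁅x⁆∣≡ {x = x} {p Subset.- x} x∉p-x))
    (cong Subset.∣_∣ (⊆-antisym
      (∪-lub x∈p─q⇒x∈p (⁅⁆⊆ x∈p)) p⊆))
    where
    p⊆ : p ⊆ (p Subset.- x) ∪ ⁅ x ⁆
    p⊆ {z} z∈p with z Finₚ.≟ x
    ... | yes refl = x∈p∪⁅x⁆
    ... | no z≢x   = ∈∪ˡ (x∈p∧x≢y⇒x∈p-y z∈p z≢x)

  ∣exchange∣ : x ∈ p → y ∉ p → Subset.∣ exchange p x y ∣ ≡ Subset.∣ p ∣
  ∣exchange∣ {x = x} {p} {y} x∈p y∉p =
    trans (∣p∪⁅x⁆∣≡ {x = y} {p Subset.- x} (y∉p ∘ x∈p─q⇒x∈p)) (suc∣p-x∣≡ {x = x} {p} x∈p)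

  ⊆∧∣∣≤⇒⊇ : p ⊆ q → Subset.∣ q ∣ ℕ.≤ Subset.∣ p ∣ → q ⊆ p
  ⊆∧∣∣≤⇒⊇ {p = p} p⊆q ∣q∣≤∣p∣ {z} z∈q = decidable-stable (z ∈? p)
    λ z∉p → ℕₚ.<⇒≱ (p⊂q⇒∣p∣<∣q∣ (p⊆q , z , z∈q , z∉p)) ∣q∣≤∣p∣

  ∣p∪⁅x⁆∣≤ : ∀ (p : Subset n) x → Subset.∣ p ∪ ⁅ x ⁆ ∣ ℕ.≤ suc Subset.∣ p ∣
  ∣p∪⁅x⁆∣≤ p x with x ∈? p
  ... | no x∉p  = ℕₚ.≤-reflexive (∣p∪⁅x⁆∣≡ {x = x} {p} x∉p)
  ... | yes x∈p = ℕₚ.m≤n⇒m≤1+n (p⊆q⇒∣p∣≤∣q∣ (∪-lub {p = p} {r = p} {q = ⁅ x ⁆} (λ z∈p → z∈p) (⁅⁆⊆ x∈p)))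

  exchange─⁻ : x ∈ q → ∀ {z} → z ∈ exchange p y x → z ∉ q → z ∈ p × z ≢ y
  exchange─⁻ x∈q z∈ z∉q with x∈p∪⁅y⁆⁻ z∈
  ... | inj₁ z∈p-y = x∈p─q⇒x∈p z∈p-y , λ { refl → x∉p-x z∈p-y }
  ... | inj₂ refl  = contradiction x∈q z∉q

  -- The incoming `x` lies in `q`, so outside `q` the exchange only loses `y`. This is the descent
  -- behind both the termination and the length bound of the matching.
  exchange─⊂ : x ∈ q → y ∈ p ─ q → exchange p y x ─ q ⊂ p ─ q
  exchange─⊂ {x = x} {q = q} {y = y} {p = p} x∈q y∈p─q =
    (λ z∈ → x∈p∧x∉q⇒x∈p─q (proj₁ (exchange─⁻ x∈q (x∈p─q⇒x∈p z∈) (x∈p─q⇒x∉q z∈))) (x∈p─q⇒x∉q z∈)) ,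
    y , y∈p─q , λ y∈ → proj₂ (exchange─⁻ x∈q (x∈p─q⇒x∈p y∈) (x∈p─q⇒x∉q y∈)) refl

  -- Double negation passes through this quantifier because there are finitely many subsets. It
  -- makes independence of all subsets decidable at once under a double negation.
  ¬¬-∀ : {P : Subset n → Set} → (∀ Z → ¬ ¬ P Z) → ¬ ¬ (∀ Z → P Z)
  ¬¬-∀ {zero} h k = h [] λ P[] → k λ { [] → P[] }
  ¬¬-∀ {suc n} h k =
    ¬¬-∀ (h ∘ (inside ∷_)) λ hᵢ → ¬¬-∀ (h ∘ (outside ∷_)) λ hₒ →
      k λ { (inside ∷ Z) → hᵢ Z ; (outside ∷ Z) → hₒ Z }

open SubsetLemmas

-- Counting occurrences in a list of subsets.

module Occurrences {n : ℕ} where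

  occurrences-∈ : ∀ {e : Fin n} {P 𝒫} → e ∈ P → occurrences e (P ∷ 𝒫) ≡ suc (occurrences e 𝒫)
  occurrences-∈ {e} {P} {𝒫} e∈P = cong length (filter-accept (e ∈?_) {P} {𝒫} e∈P)

  occurrences-∉ : ∀ {e : Fin n} {P 𝒫} → e ∉ P → occurrences e (P ∷ 𝒫) ≡ occurrences e 𝒫
  occurrences-∉ {e} {P} {𝒫} e∉P = cong length (filter-reject (e ∈?_) {P} {𝒫} e∉P)

  occurrences-∷-≤ : ∀ {e : Fin n} P 𝒫 → occurrences e 𝒫 ℕ.≤ occurrences e (P ∷ 𝒫)
  occurrences-∷-≤ {e} P 𝒫 = by-cases (e ∈? P)
    where
    by-cases : Dec (e ∈ P) → occurrences e 𝒫 ℕ.≤ occurrences e (P ∷ 𝒫)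
    by-cases (yes e∈P) = subst (occurrences e 𝒫 ℕ.≤_) (sym (occurrences-∈ {e} {P = P} {𝒫} e∈P)) (ℕₚ.n≤1+n _)
    by-cases (no e∉P)  = ℕₚ.≤-reflexive (sym (occurrences-∉ {P = P} {𝒫} e∉P))

  occurrences-none : ∀ {e : Fin n} {𝒫} → All (e ∉_) 𝒫 → occurrences e 𝒫 ≡ 0
  occurrences-none []            = refl
  occurrences-none {𝒫 = _ ∷ 𝒫} (e∉P ∷ e∉𝒫) = trans (occurrences-∉ {𝒫 = 𝒫} e∉P) (occurrences-none e∉𝒫)

open Occurrences

-- Matroid bases, symmetric exchange and the matching of swaps.

module MatroidLemmas {n : ℕ} (M : Matroid n) where

  open Matroid M using (hereditary; augmentation)

  -- Augmentation iterated from the same `J`. The bound `Z ⊆ I ∪ J` is what later locates the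
  -- elements gained.
  extend : ∀ k {I J} → Indep M I → Indep M J → Subset.∣ J ∣ ≡ k ℕ.+ Subset.∣ I ∣ →
    ∃[ Z ] (Indep M Z × I ⊆ Z × Z ⊆ I ∪ J × Subset.∣ Z ∣ ≡ Subset.∣ J ∣)
  extend zero {I} indI indJ eq = I , indI , (λ z → z) , ∈∪ˡ , sym eq
  extend (suc k) {I} {J} indI indJ eq
    with augmentation indI indJ (subst (Subset.∣ I ∣ ℕ.<_) (sym eq) (ℕ.s≤s (ℕₚ.m≤n+m _ k)))
  ... | e , e∈J , e∉I , indI′
    with extend k indI′ indJ (trans eq (trans (sym (ℕₚ.+-suc k _)) (cong (k ℕ.+_) (sym (∣p∪⁅x⁆∣≡ e∉I)))))
  ... | Z , indZ , I′⊆Z , Z⊆ , ∣Z∣ =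
    Z , indZ , I′⊆Z ∘ ∈∪ˡ , ∪-lub (∪-lub ∈∪ˡ (∈∪ʳ ∘ ⁅⁆⊆ e∈J)) ∈∪ʳ ∘ Z⊆ , ∣Z∣

  extend-≤ : ∀ {I J} → Indep M I → Indep M J → Subset.∣ I ∣ ℕ.≤ Subset.∣ J ∣ →
    ∃[ Z ] (Indep M Z × I ⊆ Z × Z ⊆ I ∪ J × Subset.∣ Z ∣ ≡ Subset.∣ J ∣)
  extend-≤ {I} {J} indI indJ ∣I∣≤∣J∣ =
    extend (Subset.∣ J ∣ ℕ.∸ Subset.∣ I ∣) indI indJ (sym (ℕₚ.m∸n+n≡m ∣I∣≤∣J∣))

  IsBase : ℕ → Subset n → Set
  IsBase s X = Indep M X × Subset.∣ X ∣ ≡ s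

  ⁅_⇄_⁆ : Fin n → Fin n → Subset n
  ⁅ x ⇄ y ⁆ = ⁅ x ⁆ ∪ ⁅ y ⁆

  IsSwap : (X B P : Subset n) → Set
  IsSwap X B P = ∃₂ λ x y → P ≡ ⁅ x ⇄ y ⁆ × x ∈ X × x ∉ B × y ∈ B × y ∉ X × Indep M (exchange X x y)

  -- The bijection is recorded only through the counts that `Localizable` asks for with `k = ℓ = 1`,
  -- plus a bound on the number of summands.
  IsMatching : (X B : Subset n) → List (Subset n) → Set
  IsMatching X B 𝒫 = All (IsSwap X B) 𝒫 × length 𝒫 ℕ.≤ Subset.∣ B ─ X ∣ ×
    (∀ {e} → e ∈ B ─ X → 1 ℕ.≤ occurrences e 𝒫) ×
    (∀ {e} → e ∈ X ─ B → occurrences e 𝒫 ℕ.≤ 1)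

  -- Swapping y for x in B keeps X fixed and brings B closer to X, so the
  -- swaps for the smaller difference are swaps of X as well.
  matching-∷ : ∀ {X B x y 𝒫} → x ∈ X → x ∉ B → y ∈ B → y ∉ X → Indep M (exchange X x y) →
    IsMatching X (exchange B y x) 𝒫 → IsMatching X B (⁅ x ⇄ y ⁆ ∷ 𝒫)
  matching-∷ {X} {B} {x} {y} {𝒫} x∈X x∉B y∈B y∉X indX′ (swaps , ∣𝒫∣ , cover , packed) =
    (x , y , refl , x∈X , x∉B , y∈B , y∉X , indX′) ∷ All.map widen swaps ,
    ℕₚ.≤-trans (ℕ.s≤s ∣𝒫∣) (p⊂q⇒∣p∣<∣q∣ {p = exchange B y x ─ X} {B ─ X}
      (exchange─⊂ x∈X (x∈p∧x∉q⇒x∈p─q y∈B y∉X))) ,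
    cover′ , packed′
    where
    B′ = exchange B y x
    ∉B : ∀ {z} → z ∈ X → z ∉ B′ → z ∉ B
    ∉B z∈X z∉B′ z∈B = z∉B′ (∈∪ˡ (x∈p∧x≢y⇒x∈p-y z∈B λ { refl → y∉X z∈X }))
    widen : ∀ {P} → IsSwap X B′ P → IsSwap X B P
    widen (u , v , eq , u∈X , u∉B′ , v∈B′ , v∉X , ind) =
      u , v , eq , u∈X , ∉B u∈X u∉B′ , proj₁ (exchange─⁻ x∈X v∈B′ v∉X) , v∉X , ind
    -- The smaller matching removes elements outside `B′` and inserts elements outside `X`, while
    -- `x` lies in both sets.
    x∉swap : ∀ {P} → IsSwap X B′ P → x ∉ P
    x∉swap (u , v , refl , u∈X , u∉B′ , v∈B′ , v∉X , ind) x∈P with x∈p∪⁅y⁆⁻ x∈P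
    ... | inj₂ refl = v∉X x∈X
    ... | inj₁ x∈u with x∈⁅y⁆⇒x≡y u x∈u
    ... | refl = u∉B′ x∈p∪⁅x⁆
    cover′ : ∀ {e} → e ∈ B ─ X → 1 ℕ.≤ occurrences e (⁅ x ⇄ y ⁆ ∷ 𝒫)
    cover′ {e} e∈ with e Finₚ.≟ y
    ... | yes refl = subst (1 ℕ.≤_) (sym (occurrences-∈ {e = e} {P = ⁅ x ⇄ y ⁆} {𝒫} x∈p∪⁅x⁆)) (ℕ.s≤s ℕ.z≤n)
    ... | no e≢y = ℕₚ.≤-trans
      (cover (x∈p∧x∉q⇒x∈p─q (∈∪ˡ (x∈p∧x≢y⇒x∈p-y (x∈p─q⇒x∈p e∈) e≢y)) (x∈p─q⇒x∉q e∈)))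
      (occurrences-∷-≤ ⁅ x ⇄ y ⁆ 𝒫)
    packed′ : ∀ {e} → e ∈ X ─ B → occurrences e (⁅ x ⇄ y ⁆ ∷ 𝒫) ℕ.≤ 1
    packed′ {e} e∈ with e Finₚ.≟ x
    ... | yes refl = ℕₚ.≤-reflexive (trans (occurrences-∈ {e = e} {P = ⁅ x ⇄ y ⁆} {𝒫} (∈∪ˡ (x∈⁅x⁆ x)))
      (cong suc (occurrences-none {e = x} {𝒫} (All.map x∉swap swaps))))
    ... | no e≢x = subst (ℕ._≤ 1) (sym (occurrences-∉ {e = e} {P = ⁅ x ⇄ y ⁆} {𝒫} e∉P))
      (packed (x∈p∧x∉q⇒x∈p─q e∈X e∉B′))
      where
      e∈X = x∈p─q⇒x∈p e∈
      e∉P : e ∉ ⁅ x ⇄ y ⁆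
      e∉P e∈P with x∈p∪⁅y⁆⁻ e∈P
      ... | inj₁ e∈x = e≢x (x∈⁅y⁆⇒x≡y x e∈x)
      ... | inj₂ refl = y∉X e∈X
      e∉B′ : e ∉ B′
      e∉B′ e∈B′ with x∈p∪⁅y⁆⁻ e∈B′
      ... | inj₁ e∈B-y = x∈p─q⇒x∉q e∈ (x∈p─q⇒x∈p e∈B-y)
      ... | inj₂ refl = e≢x refl

  module _ {s : ℕ} (rank : IsRank M s) where

    ∣indep∣≤s : ∀ {X} → Indep M X → Subset.∣ X ∣ ℕ.≤ s
    ∣indep∣≤s = proj₂ rank _

    base⊇ : ∀ {I} → Indep M I → ∃[ B ] (IsBase s B × I ⊆ B)
    base⊇ indI with proj₁ rank
    ... | J , indJ , ∣J∣≡s with extend-≤ indI indJ (subst (_ ℕ.≤_) (sym ∣J∣≡s) (∣indep∣≤s indI))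
    ... | B , indB , I⊆B , _ , ∣B∣ = B , (indB , trans ∣B∣ ∣J∣≡s) , I⊆B

    maximal⇒base : ∀ {X} → Maximal M X → IsBase s X
    maximal⇒base (indX , max) with base⊇ indX
    ... | B , base@(indB , _) , X⊆B with max B indB X⊆B
    ... | refl = base

    exchange-base : ∀ {X x x′} → IsBase s X → Exchangeable M X x x′ → IsBase s (exchange X x x′)
    exchange-base (indX , ∣X∣) (x∈X , x′∉X , ind) = ind , trans (∣exchange∣ x∈X x′∉X) ∣X∣

    module _ (indep? : ∀ Z → Dec (Indep M Z)) where

      -- Elements are deleted while dependence survives. The search for a deletable element is where
      -- decidable independence enters.
      minimal-dependent : ∀ {y D} → Acc _⊂_ D → ¬ Indep M (D ∪ ⁅ y ⁆) →
        ∃[ C ] (C ⊆ D × ¬ Indep M (C ∪ ⁅ y ⁆) ×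
          (∀ {x} → x ∈ C → Indep M ((C Subset.- x) ∪ ⁅ y ⁆)))
      minimal-dependent {y} {D} (acc rs) dep
        with Finₚ.any? (λ x → (x ∈? D) ×-dec ¬? (indep? ((D Subset.- x) ∪ ⁅ y ⁆)))
      ... | no ¬∃ = D , (λ z → z) , dep , λ {x} x∈D →
        decidable-stable (indep? _) λ dep-x → ¬∃ (x , x∈D , dep-x)
      ... | yes (x , x∈D , dep-x) with minimal-dependent (rs (x∈p⇒p-x⊂p x∈D)) dep-x
      ... | C , C⊆ , rest = C , x∈p─q⇒x∈p ∘ C⊆ , rest

      -- C + y is the fundamental circuit of y in X; it meets the fundamental
      -- cocircuit of y in B in a second element x.
      symmetric-exchange : ∀ {X B y} → IsBase s X → IsBase s B → y ∈ B → y ∉ X →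
        ∃[ x ] (x ∈ X × x ∉ B × Indep M (exchange X x y) × Indep M (exchange B y x))
      symmetric-exchange {X} {B} {y} (indX , ∣X∣) (indB , ∣B∣) y∈B y∉X
        with minimal-dependent {y} {X} (⊂-wellFounded X)
               (λ ind → ℕₚ.<⇒≱ (ℕₚ.≤-reflexive (sym (trans (∣p∪⁅x⁆∣≡ y∉X) (cong suc ∣X∣)))) (∣indep∣≤s ind))
      ... | C , C⊆X , depC , minC
        -- A base `Z` between `C` and `C ∪ B` cannot contain `y`. Hence the element of `Z` that
        -- augments `B - y` is not `y`, lies outside `B`, and so belongs to `C`.
        with extend-≤ (hereditary C⊆X indX) indB
               (subst (_ ℕ.≤_) (sym ∣B∣) (∣indep∣≤s (hereditary C⊆X indX)))
      ... | Z , indZ , C⊆Z , Z⊆C∪B , ∣Z∣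
        with augmentation {B Subset.- y} {Z} (hereditary x∈p─q⇒x∈p indB) indZ
               (ℕₚ.≤-reflexive (trans (suc∣p-x∣≡ y∈B) (sym ∣Z∣)))
      ... | x , x∈Z , x∉B-y , ind = x , C⊆X x∈C , x∉B , indX′ , ind
        where
        y∉Z : y ∉ Z
        y∉Z y∈Z = depC (hereditary (∪-lub C⊆Z (⁅⁆⊆ y∈Z)) indZ)
        x≢y : x ≢ y
        x≢y x≡y = y∉Z (subst (_∈ Z) x≡y x∈Z)
        x∉B : x ∉ B
        x∉B x∈B = x∉B-y (x∈p∧x≢y⇒x∈p-y x∈B x≢y)
        x∈C : x ∈ C
        x∈C with x∈p∪q⁻ C B (Z⊆C∪B x∈Z)
        ... | inj₁ x∈C = x∈C
        ... | inj₂ x∈B = contradiction x∈B x∉B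
        -- `C - x + y`, independent by minimality, grows inside `X + y` to a set `W` as large as
        -- `X`. Since `x ∈ W` would bring in all of `C + y`, cardinality forces `W` to be
        -- `X - x + y`.
        indX′ : Indep M (exchange X x y)
        indX′ with extend-≤ (minC x∈C) indX (subst (_ ℕ.≤_) (sym ∣X∣) (∣indep∣≤s (minC x∈C)))
        ... | W , indW , C-x+y⊆W , W⊆ , ∣W∣ = hereditary (⊆∧∣∣≤⇒⊇ W⊆X-x+y ∣X-x+y∣≤∣W∣) indW
          where
          y∈W : y ∈ W
          y∈W = C-x+y⊆W x∈p∪⁅x⁆
          C⊆W : x ∈ W → C ⊆ W
          C⊆W x∈W {z} z∈C with z Finₚ.≟ x
          ... | yes refl = x∈W
          ... | no z≢x   = C-x+y⊆W (∈∪ˡ (x∈p∧x≢y⇒x∈p-y z∈C z≢x))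
          x∉W : x ∉ W
          x∉W x∈W = depC (hereditary (∪-lub (C⊆W x∈W) (⁅⁆⊆ y∈W)) indW)
          W⊆X+y : W ⊆ X ∪ ⁅ y ⁆
          W⊆X+y = ∪-lub (∪-lub (∈∪ˡ ∘ C⊆X ∘ x∈p─q⇒x∈p) ∈∪ʳ) ∈∪ˡ ∘ W⊆
          W⊆X-x+y : W ⊆ exchange X x y
          W⊆X-x+y {z} z∈W with x∈p∪⁅y⁆⁻ (W⊆X+y z∈W)
          ... | inj₂ refl = x∈p∪⁅x⁆
          ... | inj₁ z∈X = ∈∪ˡ (x∈p∧x≢y⇒x∈p-y z∈X λ { refl → x∉W z∈W })
          ∣X-x+y∣≤∣W∣ : Subset.∣ exchange X x y ∣ ℕ.≤ Subset.∣ W ∣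
          ∣X-x+y∣≤∣W∣ = ℕₚ.≤-reflexive (trans (∣exchange∣ (C⊆X x∈C) y∉X) (sym ∣W∣))

      matching : ∀ {X B} → Acc _⊂_ (B ─ X) → IsBase s X → IsBase s B → ∃[ 𝒫 ] IsMatching X B 𝒫
      matching {X} {B} (acc rs) baseX baseB with nonempty? (B ─ X)
      ... | no empty = [] , [] , ℕ.z≤n , (λ e∈ → contradiction (_ , e∈) empty) , λ _ → ℕ.z≤n
      ... | yes (y , y∈B─X) =
        let x , x∈X , x∉B , indX′ , indB′ = symmetric-exchange baseX baseB y∈B y∉X
            𝒫 , m = matching {X} {exchange B y x}
              (rs (exchange─⊂ {x = x} {q = X} {y = y} {p = B} x∈X y∈B─X)) baseX
              (exchange-base baseB (y∈B , x∉B , indB′))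
        in ⁅ x ⇄ y ⁆ ∷ 𝒫 , matching-∷ {x = x} {y} {𝒫} x∈X x∉B y∈B y∉X indX′ m
        where
        y∈B = x∈p─q⇒x∈p {p = B} {q = X} y∈B─X
        y∉X = x∈p─q⇒x∉q {p = B} {q = X} y∈B─X

-- Symmetric difference with a pair as an exchange.

module _ {n : ℕ} where

  △-swap : ∀ {X : Subset n} {x y} → x ∈ X → y ∉ X → X △ (⁅ x ⁆ ∪ ⁅ y ⁆) ≡ exchange X x y
  △-swap {X} {x} {y} x∈X y∉X = ⊆-antisym (∪-lub kept new) (∪-lub kept′ (⁅⁆⊆ y∈))
    where
    P = ⁅ x ⁆ ∪ ⁅ y ⁆
    kept : X ─ P ⊆ exchange X x y
    kept z∈ = ∈∪ˡ (x∈p∧x≢y⇒x∈p-y (x∈p─q⇒x∈p z∈) λ { refl → x∈p─q⇒x∉q z∈ (∈∪ˡ (x∈⁅x⁆ x)) })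
    new : P ─ X ⊆ exchange X x y
    new z∈ with x∈p∪⁅y⁆⁻ (x∈p─q⇒x∈p z∈)
    ... | inj₂ refl = x∈p∪⁅x⁆
    ... | inj₁ z∈x with x∈⁅y⁆⇒x≡y x z∈x
    ... | refl = contradiction x∈X (x∈p─q⇒x∉q z∈)
    kept′ : X Subset.- x ⊆ X △ P
    kept′ {z} z∈ = ∈∪ˡ (x∈p∧x∉q⇒x∈p─q (x∈p─q⇒x∈p z∈) z∉P)
      where
      z∉P : z ∉ P
      z∉P z∈P with x∈p∪⁅y⁆⁻ z∈P
      ... | inj₂ refl = y∉X (x∈p─q⇒x∈p z∈)
      ... | inj₁ z∈x  = x∈p─q⇒x∉q z∈ z∈x
    y∈ : y ∈ X △ P
    y∈ = ∈∪ʳ (x∈p∧x∉q⇒x∈p─q x∈p∪⁅x⁆ y∉X)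

-- Analysis of the local search.

module LocalSearch {n : ℕ} (M : Matroid n) {s : ℕ} (rank : IsRank M s)
  (f : Subset n → ℝ) (α β₁ β₂ : ℝ) (loc : Localizable f α β₁ β₂ s 2) where

  open MatroidLemmas M
  open +-*-Solver using (solve; _:+_; _:-_; _:*_; _:=_; con; :-_)
  open ≤-Reasoning

  β : ℝ
  β = β₁ + β₂

  swap-bounds : ∀ {X B P} → IsSwap X B P → P ⊆ X △ B × Subset.∣ P ∣ ℕ.≤ 2
  swap-bounds (x , y , refl , x∈X , x∉B , y∈B , y∉X , _) =
    ∪-lub (⁅⁆⊆ (∈∪ˡ (x∈p∧x∉q⇒x∈p─q x∈X x∉B))) (⁅⁆⊆ (∈∪ʳ (x∈p∧x∉q⇒x∈p─q y∈B y∉X))) ,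
    subst (λ k → Subset.∣ ⁅ x ⁆ ∪ ⁅ y ⁆ ∣ ℕ.≤ suc k) (∣⁅x⁆∣≡1 x) (∣p∪⁅x⁆∣≤ ⁅ x ⁆ y)

  gap≤s*gain : ∀ {X B δ} → IsBase s X → IsBase s B → 0ℝ ≤ δ →
    (∀ x x′ → Exchangeable M X x x′ → f (exchange X x x′) - f X ≤ δ) →
    α * f B - β * f X ≤ fromℕ s * δ
  gap≤s*gain {X} {B} {δ} baseX baseB 0≤δ gain≤δ =
    ≤-stable {α * f B - β * f X} {fromℕ s * δ} λ ¬goal →
      ¬¬-∀ {P = λ Z → Dec (Indep M Z)} (λ _ → ¬¬-excluded-middle) λ indep? →
        ¬goal (by-matching (matching rank indep? (⊂-wellFounded (B ─ X)) baseX baseB))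
    where
    by-matching : ∃[ 𝒫 ] IsMatching X B 𝒫 → α * f B - β * f X ≤ fromℕ s * δ
    by-matching (𝒫 , swaps , ∣𝒫∣ , cover , packed) = begin
      α * f B - β * f X
        ≈⟨ (λ n → solve 5 (λ a b c x y → a :* x :- (b :+ c) :* y
             := a :* con 1ℚ :* x :- (b :* con 1ℚ :+ c :* con 1ℚ) :* y) refl
             (seq α n) (seq β₁ n) (seq β₂ n) (seq (f B) n) (seq (f X) n)) ⟩
      α * fromℕ 1 * f B - (β₁ * fromℕ 1 + β₂ * fromℕ 1) * f X
        ≤⟨ proj₂ (proj₂ (proj₂ loc)) X B (ℕₚ.≤-reflexive (proj₂ baseX)) (ℕₚ.≤-reflexive (proj₂ baseB))
             𝒫 (All.map swap-bounds swaps) 1 1 (ℕ.s≤s ℕ.z≤n) (ℕ.s≤s ℕ.z≤n) cover packed ⟩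
      sum (map (λ P → f (X △ P) - f X) 𝒫)
        ≤⟨ sum-map≤length* (λ P → f (X △ P) - f X) δ (All.map swap-gain swaps) ⟩
      fromℕ (length 𝒫) * δ
        -- There may be fewer than `s` swaps when `X` and `B` intersect; rounding up to `s` relies
        -- on `0 ≤ δ`.
        ≤⟨ *-monoʳ-≤ δ {fromℕ (length 𝒫)} {fromℕ s} 0≤δ
             (≤ᵉ⇒≤ {fromℕ (length 𝒫)} {fromℕ s} (0 , λ _ _ → ι-mono ∣𝒫∣≤s)) ⟩
      fromℕ s * δ ∎
      where
      ∣𝒫∣≤s : length 𝒫 ℕ.≤ s
      ∣𝒫∣≤s = ℕₚ.≤-trans ∣𝒫∣ (subst (Subset.∣ B ─ X ∣ ℕ.≤_) (proj₂ baseB) (∣p─q∣≤∣p∣ B X))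
      swap-gain : ∀ {P} → IsSwap X B P → f (X △ P) - f X ≤ δ
      swap-gain (x , y , refl , x∈X , x∉B , y∈B , y∉X , ind) =
        subst (λ Y → f Y - f X ≤ δ) (sym (△-swap x∈X y∉X)) (gain≤δ x y (x∈X , y∉X , ind))

  module _ (nonneg : NonNegative f) (mono : Monotone f) (β>0 : 0ℝ < β)
    {X* : Subset n} (indX* : Indep M X*) where

    a r : ℝ
    a = div α β β>0 * f X*
    r = recip β β>0

    0≤a : 0ℝ ≤ a
    0≤a = 0≤*ℝ {α * r} {f X*} (0≤*ℝ {α} {r} (proj₁ loc) (0≤recip {β} β>0)) (nonneg X*)

    -- Multiplying by `β` cancels the division inside `a` using just `r * β ≤ 1`, in the direction
    -- allowed by `0 ≤ α * f X*`. Monotonicity then replaces `X*` by a base above it.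
    β[a-f]≤s*gain : ∀ {X δ} → IsBase s X → 0ℝ ≤ δ →
      (∀ x x′ → Exchangeable M X x x′ → f (exchange X x x′) - f X ≤ δ) →
      β * (a - f X) ≤ fromℕ s * δ
    β[a-f]≤s*gain {X} {δ} baseX 0≤δ gain≤δ with base⊇ rank indX*
    ... | B , baseB , X*⊆B = begin
      β * (a - f X)
        ≈⟨ (λ n → solve 5 (λ b α r x y → b :* (α :* r :* x :- y) := α :* x :* (r :* b) :- b :* y) refl
             (seq β n) (seq α n) (seq r n) (seq (f X*) n) (seq (f X) n)) ⟩
      α * f X* * (r * β) - β * f X
        ≤⟨ +-monoˡ-≤ (- (β * f X)) {α * f X* * (r * β)} {α * f X* * 1ℝ}
             (*-monoˡ-≤ (α * f X*) {r * β} {1ℝ} (0≤*ℝ {α} {f X*} (proj₁ loc) (nonneg X*)) (recip*x≤1 {β} β>0)) ⟩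
      α * f X* * 1ℝ - β * f X
        ≈⟨ (λ n → cong (ℚ._- seq (β * f X) n) (ℚₚ.*-identityʳ (seq (α * f X*) n))) ⟩
      α * f X* - β * f X
        ≤⟨ +-monoˡ-≤ (- (β * f X)) {α * f X*} {α * f B} (*-monoˡ-≤ α {f X*} {f B} (proj₁ loc) (mono X*⊆B)) ⟩
      α * f B - β * f X
        ≤⟨ gap≤s*gain {X} {B} {δ} baseX baseB 0≤δ gain≤δ ⟩
      fromℕ s * δ ∎

    after⇒base : ∀ {i X} → After M f i X → IsBase s X
    after⇒base (init _ max)               = maximal⇒base rank max
    after⇒base (step after (exch , _) _) = exchange-base rank (after⇒base after) exch

    stopped⇒a≤f : ∀ {T X} → Stopped M f T X → a ≤ f X
    stopped⇒a≤f {T} {X} (i , _ , after , stuck) =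
      0≤y-x⇒x≤y {a} {f X} (begin
        0ℝ                ≤⟨ x≤y⇒0≤y-x {a - f X} {0ℝ} a-f≤0 ⟩
        0ℝ - (a - f X)    ≈⟨ (λ n → solve 2 (λ a x → con 0ℚ :- (a :- x) := x :- a) refl (seq a n) (seq (f X) n)) ⟩
        f X - a           ∎)
      where
      a-f≤0 : a - f X ≤ 0ℝ
      a-f≤0 = *-cancelʳ-≤ β {a - f X} {0ℝ} β>0 (begin
        (a - f X) * β   ≈⟨ (λ n → ℚₚ.*-comm (seq (a - f X) n) (seq β n)) ⟩
        -- `stuck` unfolds to the gain bound with `δ = 0`. Only `β` gets cancelled, so rank 0 is
        -- included.
        β * (a - f X)   ≤⟨ β[a-f]≤s*gain {X} {0ℝ} (after⇒base after) (≤-refl {0ℝ}) stuck ⟩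
        fromℕ s * 0ℝ    ≈⟨ (λ n → trans (ℚₚ.*-zeroʳ (seq (fromℕ s) n)) (sym (ℚₚ.*-zeroˡ (seq β n)))) ⟩
        0ℝ * β          ∎)

    module _ (0<s : 0ℝ < fromℕ s) where

      u t : ℝ
      u = recip (fromℕ s) 0<s
      t = β * u

      0≤t : (λ _ → 0ℚ) ≤ᵉ seq t
      0≤t = mapᵉ (λ n 0≤β → 0≤* 0≤β (0≤seq-recip {fromℕ s} 0<s n)) (0<x⇒0≤ᵉx {β} β>0)

      0≤it : ∀ i → (λ _ → 0ℚ) ≤ᵉ seq (fromℕ i * t)
      0≤it i = mapᵉ (λ n → 0≤* (0≤ι i)) 0≤t

      a-f-contracts : ∀ {X x x′} → IsBase s X → Best M f X x x′ → Improves M f X x x′ →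
        a - f (exchange X x x′) ≤ (1ℝ - t) * (a - f X)
      a-f-contracts {X} {x} {x′} baseX (_ , best) improves =
        0≤y-x⇒x≤y {a - f′} {(1ℝ - t) * (a - f X)} (begin
          0ℝ
            ≤⟨ x≤y⇒0≤y-x {t * (a - f X)} {D} t[a-f]≤D ⟩
          D - t * (a - f X)
            ≈⟨ (λ n → solve 4 (λ y x a t → (y :- x) :- t :* (a :- x)
                 := (con 1ℚ :- t) :* (a :- x) :- (a :- y)) refl
                 (seq f′ n) (seq (f X) n) (seq a n) (seq t n)) ⟩
          (1ℝ - t) * (a - f X) - (a - f′) ∎)
        where
        f′ = f (exchange X x x′)
        D = f′ - f X
        0≤D : 0ℝ ≤ D
        0≤D = <⇒≤ {0ℝ} {D} improves
        t[a-f]≤D : t * (a - f X) ≤ D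
        t[a-f]≤D = begin
          t * (a - f X)
            ≈⟨ (λ n → solve 3 (λ b u g → b :* u :* g := u :* (b :* g)) refl
                 (seq β n) (seq u n) (seq (a - f X) n)) ⟩
          u * (β * (a - f X))
            ≤⟨ *-monoˡ-≤ u {β * (a - f X)} {fromℕ s * D} (0≤recip {fromℕ s} 0<s)
                 (β[a-f]≤s*gain {X} {D} baseX 0≤D λ y y′ exch →
                   +-monoˡ-≤ (- f X) {f (exchange X y y′)} {f′} (best y y′ exch)) ⟩
          u * (fromℕ s * D)
            ≈⟨ (λ n → sym (ℚₚ.*-assoc (seq u n) (seq (fromℕ s) n) (seq D n))) ⟩
          u * fromℕ s * D
            ≤⟨ *-monoʳ-≤ D {u * fromℕ s} {1ℝ} 0≤D (recip*x≤1 {fromℕ s} 0<s) ⟩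
          1ℝ * D
            ≈⟨ (λ n → ℚₚ.*-identityˡ (seq D n)) ⟩
          D ∎

      [a-f]*exp≤a : ∀ {i X} → After M f i X → (a - f X) * exp (fromℕ i * t) ≤ a
      [a-f]*exp≤a {zero} {X} (init _ _) = begin
        (a - f X) * exp (fromℕ 0 * t)
          ≈⟨ (λ n → trans (cong (λ z → seq (a - f X) n ℚ.* z)
               (trans (cong (λ z → expSum z n) (ℚₚ.*-zeroˡ (seq t n))) (expSum-0 n)))
               (ℚₚ.*-identityʳ (seq (a - f X) n))) ⟩
        a - f X
          ≤⟨ 0≤y-x⇒x≤y {a - f X} {a} (begin
               0ℝ             ≤⟨ nonneg X ⟩
               f X            ≈⟨ (λ n → solve 2 (λ a x → x := a :- (a :- x)) refl (seq a n) (seq (f X) n)) ⟩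
               a - (a - f X)  ∎) ⟩
        a ∎
      [a-f]*exp≤a {suc i} (step {X = X} {x} {x′} after best improves) =
        -- The split fixes signs. If `f′` passes `a`, the left side is at most 0; otherwise `g′` is
        -- nonnegative, and so is `g` because the step improved `f`. The sign of `1 - t`, negative
        -- when `β > s`, never matters.
        ≤-cases a f′ {g′ * E′} {a} overshoot undershoot
        where
        f′ = f (exchange X x x′)
        g g′ E E′ e : ℝ
        g = a - f X
        g′ = a - f′
        E = exp (fromℕ i * t)
        E′ = exp (fromℕ (suc i) * t)
        e = exp t
        0≤E : 0ℝ ≤ E
        0≤E = <⇒≤ {0ℝ} {E} (0<exp {fromℕ i * t} (0≤it i))
        0≤E′ : 0ℝ ≤ E′
        0≤E′ = <⇒≤ {0ℝ} {E′} (0<exp {fromℕ (suc i) * t} (0≤it (suc i)))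
        0≤e : 0ℝ ≤ e
        0≤e = <⇒≤ {0ℝ} {e} (0<exp {t} 0≤t)
        E′≤Ee : E′ ≤ E * e
        E′≤Ee = begin
          E′
            ≈⟨ (λ n → cong (λ z → expSum z n) (trans (cong (ℚ._* seq t n) (ι-suc i))
                 (solve 2 (λ i t → (con 1ℚ :+ i) :* t := i :* t :+ t) refl (ι i) (seq t n)))) ⟩
          exp (fromℕ i * t + t)
            ≤⟨ exp≤exp*exp (fromℕ i * t) t ⟩
          E * e ∎
        overshoot : a ≤ f′ → g′ * E′ ≤ a
        overshoot a≤f′ = begin
          g′ * E′    ≤⟨ *-monoʳ-≤ E′ {g′} {0ℝ} 0≤E′ (begin
            a - f′     ≤⟨ +-monoˡ-≤ (- f′) {a} {f′} a≤f′ ⟩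
            f′ - f′    ≈⟨ (λ n → ℚₚ.+-inverseʳ (seq f′ n)) ⟩
            0ℝ         ∎) ⟩
          0ℝ * E′    ≈⟨ (λ n → ℚₚ.*-zeroˡ (seq E′ n)) ⟩
          0ℝ         ≤⟨ 0≤a ⟩
          a          ∎
        undershoot : f′ ≤ a → g′ * E′ ≤ a
        undershoot f′≤a = begin
          g′ * E′
            ≤⟨ *-monoˡ-≤ g′ {E′} {E * e} (x≤y⇒0≤y-x {f′} {a} f′≤a) E′≤Ee ⟩
          g′ * (E * e)
            ≤⟨ *-monoʳ-≤ (E * e) {g′} {(1ℝ - t) * g} (0≤*ℝ {E} {e} 0≤E 0≤e)
                 (a-f-contracts (after⇒base after) best improves) ⟩
          (1ℝ - t) * g * (E * e)
            ≈⟨ (λ n → solve 4 (λ t g E e → (con 1ℚ :- t) :* g :* (E :* e)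
                 := (con 1ℚ :- t) :* e :* (g :* E)) refl (seq t n) (seq g n) (seq E n) (seq e n)) ⟩
          (1ℝ - t) * e * (g * E)
            ≤⟨ *-monoʳ-≤ (g * E) {(1ℝ - t) * e} {1ℝ} (0≤*ℝ {g} {E} 0≤g 0≤E) ([1-x]*exp[x]≤1 {t} 0≤t) ⟩
          1ℝ * (g * E)
            ≈⟨ (λ n → ℚₚ.*-identityˡ (seq (g * E) n)) ⟩
          g * E
            ≤⟨ [a-f]*exp≤a after ⟩
          a ∎
          where
          0≤g : 0ℝ ≤ g
          0≤g = x≤y⇒0≤y-x {f X} {a} (≤-trans {f X} {f′} {a}
            (0≤y-x⇒x≤y {f X} {f′} (<⇒≤ {0ℝ} {f′ - f X} improves)) f′≤a)

      after⇒bound : ∀ {T X} → After M f T X →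
        a - exp (- (div (β * fromℕ T) (fromℕ s) 0<s)) * a ≤ f X
      after⇒bound {T} {X} after = 0≤y-x⇒x≤y {a - e⁻ * a} {f X} (begin
        0ℝ
          ≤⟨ x≤y⇒0≤y-x {a - f X} {e⁻ * a} a-f≤e⁻a ⟩
        e⁻ * a - (a - f X)
          ≈⟨ (λ n → solve 3 (λ a x e → e :* a :- (a :- x) := x :- (a :- e :* a)) refl
               (seq a n) (seq (f X) n) (seq e⁻ n)) ⟩
        f X - (a - e⁻ * a) ∎)
        where
        z e⁻ : ℝ
        z = div (β * fromℕ T) (fromℕ s) 0<s
        e⁻ = exp (- z)
        z≡Tt : ∀ n → seq z n ≡ seq (fromℕ T * t) n
        z≡Tt n = solve 3 (λ b i u → b :* i :* u := i :* (b :* u)) refl (seq β n) (ι T) (seq u n)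
        a-f≤e⁻a : a - f X ≤ e⁻ * a
        -- Cancelling the positive `exp z` moves the exponential of the invariant to the other side,
        -- so no reciprocal of `exp z` is formed.
        a-f≤e⁻a = *-cancelʳ-≤ (exp z) {a - f X} {e⁻ * a}
          (0<exp {z} (mapᵉ (λ n → subst (0ℚ ℚ.≤_) (sym (z≡Tt n))) (0≤it T))) (begin
          (a - f X) * exp z
            ≈⟨ (λ n → cong (λ w → seq (a - f X) n ℚ.* expSum w n) (z≡Tt n)) ⟩
          (a - f X) * exp (fromℕ T * t)
            ≤⟨ [a-f]*exp≤a after ⟩
          a
            ≈⟨ (λ n → sym (ℚₚ.*-identityʳ (seq a n))) ⟩
          a * 1ℝ
            ≤⟨ *-monoˡ-≤ a {1ℝ} {e⁻ * exp z} 0≤a (1≤exp[-x]*exp[x] z) ⟩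
          a * (e⁻ * exp z)
            ≈⟨ (λ n → solve 3 (λ a d e → a :* (d :* e) := d :* a :* e) refl
                 (seq a n) (seq e⁻ n) (seq (exp z) n)) ⟩
          e⁻ * a * exp z ∎)

      output⇒bound : ∀ {T X} → Output M f T X →
        div α β β>0 * (1ℝ - exp (- (div (β * fromℕ T) (fromℕ s) 0<s))) * f X* ≤ f X
      output⇒bound {T} {X} output = begin
        div α β β>0 * (1ℝ - e⁻) * f X*
          ≈⟨ (λ n → solve 3 (λ d e x → d :* (con 1ℚ :- e) :* x := d :* x :- e :* (d :* x)) refl
               (seq (div α β β>0) n) (seq e⁻ n) (seq (f X*) n)) ⟩
        a - e⁻ * a
          ≤⟨ by-output output ⟩
        f X ∎
        where
        z e⁻ : ℝ
        z = div (β * fromℕ T) (fromℕ s) 0<s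
        e⁻ = exp (- z)
        0≤z : (λ _ → 0ℚ) ≤ᵉ seq z
        0≤z = mapᵉ (λ n → subst (0ℚ ℚ.≤_)
          (solve 3 (λ b i u → i :* (b :* u) := b :* i :* u) refl (seq β n) (ι T) (seq u n))) (0≤it T)
        by-output : Output M f T X → a - e⁻ * a ≤ f X
        by-output (inj₁ after)   = after⇒bound after
        -- An early stop already gives `a ≤ f X`; subtracting the nonnegative `e⁻ * a` only weakens
        -- it.
        by-output (inj₂ stopped) = begin
          a - e⁻ * a
            ≤⟨ 0≤y-x⇒x≤y {a - e⁻ * a} {a} (begin
                 0ℝ                 ≤⟨ 0≤*ℝ {e⁻} {a} (0≤exp[-x] {z} 0≤z) 0≤a ⟩
                 e⁻ * a             ≈⟨ (λ n → solve 2 (λ a b → b := a :- (a :- b)) refl (seq a n) (seq (e⁻ * a) n)) ⟩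
                 a - (a - e⁻ * a)   ∎) ⟩
          a
            ≤⟨ stopped⇒a≤f stopped ⟩
          f X ∎

theorem9 :
    (n : ℕ) (M : Matroid n) (s : ℕ) → IsRank M s →
    (f : Subset n → ℝ) → NonNegative f → Monotone f →
    (α β₁ β₂ : ℝ) → Localizable f α β₁ β₂ s 2 →
    (β>0 : 0ℝ < β₁ + β₂) →
    (X* : Subset n) → Optimal M f X* →
    (∀ (T : ℕ) (X : Subset n) .{{_ : NonZero s}} → Output M f T X →
      div α (β₁ + β₂) β>0
        * (1ℝ - exp (- div ((β₁ + β₂) * fromℕ T) (fromℕ s) (0<fromℕ s)))
        * f X*
      ≤ f X)
    ×
    (∀ (T : ℕ) (X : Subset n) → Stopped M f T X →
      div α (β₁ + β₂) β>0 * f X* ≤ f X)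
theorem9 n M s rank f nonneg mono α β₁ β₂ loc β>0 X* (indX* , _) =
  (λ T X → output⇒bound nonneg mono β>0 indX* (0<fromℕ s)) ,
  (λ T X → stopped⇒a≤f nonneg mono β>0 indX*)
  where open LocalSearch M rank f α β₁ β₂ loc
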